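{- The SubCubeSums proof system $p$-simulates MaxResW. Quantitatively: there is a polynomial-time procedure and an absolute constant $K$ such that, for every unsatisfiable CNF formula $F$ with $n$ variables and $m$ clauses, the procedure converts any MaxResW refutation of $F$ of size $s$ into a SubCubeSums proof for $F$ whose combinatorial size and whose algebraic size are both at most $K(m+ns)$.
   Context: Clauses are disjunctions of sets of literals with no complementary pair $x,\overline{x}$. For a multi-set $F$ of clauses over variables $X$ and a total assignment $\alpha\in\{0,1\}^X$, $\mathrm{viol}_F(\alpha)$ is the number of clauses of $F$ (with multiplicity) falsified by $\alpha$. MaxSAT resolution rule: from $x\vee A$ and $\overline{x}\vee B$ with $A=a_1\vee\dots\vee a_s$, $B=b_1\vee\dots\vee b_t$, derive $A\vee B$; the clauses $x\vee A\vee b_1\vee\dots\vee b_{j-1}\vee\overline{b_j}$ for $1\le j\le t$; and the clauses $\overline{x}\vee B\vee a_1\vee\dots\vee a_{j-1}\vee\overline{a_j}$ for $1\le j\le s$. Weakening rule: replace a clause $A$ by the two clauses $A\vee x$ and $A\vee\overline{x}$. When a rule is applied to a multi-set of clauses, (one copy of) each antecedent is removed and all non-tautologous consequents are added. A MaxResW refutation of $F$ is a sequence of multi-sets $F=F_0,F_1,\dots,F_s$, each obtained from the previous one by one application of the MaxSAT resolution rule or the weakening rule, with $F_s$ containing the empty clause; its size is $s$. A SubCubeSums proof for an unsatisfiable CNF $F$ over $X$ is a multi-set $G$ of clauses over $X$ with $\mathrm{viol}_F(\alpha)=1+\mathrm{viol}_G(\alpha)$ for all $\alpha\in\{0,1\}^X$.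 Its combinatorial size is the number of clauses of $G$ counted with multiplicity. Algebraic size: use $2n$ formal variables $x_j,\overline{x_j}$ ($j\in[n]$). Encode the literal $x_j$ by $e(x_j)=\overline{x_j}$, the literal $\neg x_j$ by $e(\neg x_j)=x_j$, and a clause by the product of the encodings of its literals. A Sherali--Adams representation of the SubCubeSums proof $G$ for $F$ is a choice of polynomials $r_j$ with integer coefficients such that, as a polynomial identity in the $2n$ variables, $$-\sum_{C\in F}e(C)+\sum_{j\in[n]}r_j(1-x_j-\overline{x_j})+\sum_{C\in G}e(C)+1=0 .$$ Its size is $|F|+|G|+\sum_j\|r_j(1-x_j-\overline{x_j})\|_1$, where $\|\cdot\|_1$ is the sum of absolute values of the coefficients of the expanded polynomial. The algebraic size of $G$ is the minimum size of such a representation. -}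

module Defs where

open import Data.Bool using (Bool; true; false; not)
import Data.Bool.Properties as Bool
open import Data.Digit using (Bit; toDigits)
open import Data.Fin using (Fin; toℕ)
open import Data.Fin.Subset using (Subset; ⊥; ⁅_⁆; _∪_; _∩_; Empty)
open import Data.Fin.Subset.Properties using (_∈?_; nonempty?)
open import Data.Integer using (ℤ; 0ℤ; 1ℤ; ∣_∣) renaming (_+_ to _+ℤ_; _*_ to _*ℤ_; -_ to -ℤ_)
open import Data.List using (List; []; _∷_; [_]; _++_; map; concatMap; filter; foldr; length; allFin; cartesianProductWith; deduplicate; mapMaybe)
open import Data.List.Relation.Binary.Permutation.Propositional using (_↭_)
open import Data.List.Relation.Unary.All using (All; all?)
open import Data.List.Relation.Unary.Any using (Any)
open import Data.List.Relation.Unary.Unique.Propositional using (Unique)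
open import Data.Maybe using (Maybe; just; nothing)
open import Data.Nat using (ℕ; zero; suc; _+_; _*_; _^_; _≤_)
open import Data.Nat.ListAction using (sum)
import Data.Nat.Properties as ℕ
open import Data.Product using (Σ-syntax; ∃-syntax; _×_; _,_; proj₁; proj₂)
import Data.Product.Properties as Product
open import Data.Vec using (Vec; replicate; zipWith; _[_]≔_)
import Data.Vec.Properties as Vec
open import Relation.Binary.Definitions using (DecidableEquality)
open import Relation.Binary.PropositionalEquality using (_≡_)
open import Relation.Nullary using (¬_; Dec; yes; no)

private
  variable
    n : ℕ

------------------------------------------------------------------------
-- Literals, clauses, formulas

data Literal (n : ℕ) : Set where
  pos neg : Fin n → Literal n

complement : Literal n → Literal n
complement (pos x) = neg x
complement (neg x) = pos x

record LitSet (n : ℕ) : Set where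
  constructor litSet
  field
    positives negatives : Subset n

open LitSet public

∅ : LitSet n
∅ = litSet ⊥ ⊥

insert : Literal n → LitSet n → LitSet n
insert (pos x) (litSet p q) = litSet (⁅ x ⁆ ∪ p) q
insert (neg x) (litSet p q) = litSet p (⁅ x ⁆ ∪ q)

⋁ : List (Literal n) → LitSet n
⋁ = foldr insert ∅

literals : LitSet n → List (Literal n)
literals {n} L =
  map pos (filter (_∈? positives L) (allFin n)) ++
  map neg (filter (_∈? negatives L) (allFin n))

Nontautologous : LitSet n → Set
Nontautologous L = Empty (positives L ∩ negatives L)

-- The consistency proof is irrelevant, so clauses with the same literals
-- are propositionally equal.
record Clause (n : ℕ) : Set where
  constructor clause
  field
    lits        : LitSet n
    .consistent : Nontautologous lits

open Clause public using (lits)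

-- A multi-set of clauses; the order of the list is disregarded by working
-- up to _↭_.
Formula : ℕ → Set
Formula n = List (Clause n)

toClause : LitSet n → Maybe (Clause n)
toClause L with nonempty? (positives L ∩ negatives L)
... | yes _         = nothing
... | no consistent = just (clause L consistent)

nontautologies : List (LitSet n) → Formula n
nontautologies = mapMaybe toClause

------------------------------------------------------------------------
-- Semantics

Assignment : ℕ → Set
Assignment n = Fin n → Bool

value : Assignment n → Literal n → Bool
value α (pos x) = α x
value α (neg x) = not (α x)

Satisfied : Assignment n → Clause n → Set
Satisfied α C = Any (λ l → value α l ≡ true) (literals (lits C))

Falsified : Assignment n → Clause n → Set
Falsified α C = All (λ l → value α l ≡ false) (literals (lits C))

falsified? : (α : Assignment n) (C : Clause n) → Dec (Falsified α C)
falsified? α C = all? (λ l → value α l Bool.≟ false) (literals (lits C))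

Unsatisfiable : Formula n → Set
Unsatisfiable F = ¬ (∃[ α ] All (Satisfied α) F)

viol : Formula n → Assignment n → ℕ
viol F α = length (filter (falsified? α) F)

------------------------------------------------------------------------
-- MaxResW

-- chain P [b₁,…,b_t] lists P ∨ b₁ ∨ … ∨ b_{j-1} ∨ ¬b_j for j = 1,…,t.
chain : LitSet n → List (Literal n) → List (LitSet n)
chain P []       = []
chain P (b ∷ bs) = insert (complement b) P ∷ chain (insert b P) bs

resolutionConsequents : Fin n → (as bs : List (Literal n)) → List (LitSet n)
resolutionConsequents x as bs =
  ⋁ (as ++ bs) ∷
  chain (⋁ (pos x ∷ as)) bs ++
  chain (⋁ (neg x ∷ bs)) as

-- The lists as and bs are arbitrary duplicate-free enumerations of A and B;
-- uniqueness also says that A does not contain x and B does not contain ¬x.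
data _⟶_ {n} (F F′ : Formula n) : Set where
  resolve : ∀ (x : Fin n) (as bs : List (Literal n)) →
            Unique (pos x ∷ as) → Unique (neg x ∷ bs) →
            ∀ (C D : Clause n) (R : Formula n) →
            lits C ≡ ⋁ (pos x ∷ as) → lits D ≡ ⋁ (neg x ∷ bs) →
            F ↭ C ∷ D ∷ R →
            F′ ↭ nontautologies (resolutionConsequents x as bs) ++ R →
            F ⟶ F′
  weaken  : ∀ (x : Fin n) (C : Clause n) (R : Formula n) →
            F ↭ C ∷ R →
            F′ ↭ nontautologies (insert (pos x) (lits C) ∷ insert (neg x) (lits C) ∷ []) ++ R →
            F ⟶ F′

infix 4 _⟶_

ContainsEmptyClause : Formula n → Set
ContainsEmptyClause F = Any (λ C → lits C ≡ ∅) F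

-- Refutations F = F₀, F₁, …, F_s, indexed by F and by the size s.
data MaxResW {n} (F : Formula n) : ℕ → Set where
  done : ContainsEmptyClause F → MaxResW F 0
  step : ∀ {F′ s} → F ⟶ F′ → MaxResW F′ s → MaxResW F (suc s)

multisets : ∀ {F : Formula n} {s} → MaxResW F s → List (Formula n)
multisets {F = F} (done _)   = [ F ]
multisets {F = F} (step _ π) = F ∷ multisets π

------------------------------------------------------------------------
-- Integer polynomials in the 2n formal variables x_j and x̄_j

-- Exponents of x₁,…,x_n and of x̄₁,…,x̄_n.
Monomial : ℕ → Set
Monomial n = Vec ℕ n × Vec ℕ n

_≟ᴹ_ : DecidableEquality (Monomial n)
_≟ᴹ_ = Product.≡-dec (Vec.≡-dec ℕ._≟_) (Vec.≡-dec ℕ._≟_)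

-- Formal sums of terms in which monomials may repeat. They denote the same
-- polynomial when all collected coefficients agree, see _≈_.
Poly : ℕ → Set
Poly n = List (ℤ × Monomial n)

coeff : Poly n → Monomial n → ℤ
coeff p m = foldr _+ℤ_ 0ℤ (map proj₁ (filter (λ t → proj₂ t ≟ᴹ m) p))

infix 4 _≈_
_≈_ : Poly n → Poly n → Set
p ≈ q = ∀ m → coeff p m ≡ coeff q m

-- Each monomial counts once, with its collected coefficient.
‖_‖₁ : Poly n → ℕ
‖ p ‖₁ = sum (map (λ m → ∣ coeff p m ∣) (deduplicate _≟ᴹ_ (map proj₂ p)))

infixl 6 _⊕_ _⊖_
infixl 7 _⊗_
infix  8 ⊖_

𝟘 : Poly n
𝟘 = []

𝟙 : Poly n
𝟙 {n} = [ 1ℤ , replicate n 0 , replicate n 0 ]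

x[_] : Fin n → Poly n
x[_] {n} j = [ 1ℤ , replicate n 0 [ j ]≔ 1 , replicate n 0 ]

x̄[_] : Fin n → Poly n
x̄[_] {n} j = [ 1ℤ , replicate n 0 , replicate n 0 [ j ]≔ 1 ]

_⊕_ : Poly n → Poly n → Poly n
p ⊕ q = p ++ q

⊖_ : Poly n → Poly n
⊖ p = map (λ (c , m) → -ℤ c , m) p

_⊖_ : Poly n → Poly n → Poly n
p ⊖ q = p ⊕ (⊖ q)

_⊗_ : Poly n → Poly n → Poly n
_⊗_ = cartesianProductWith λ (c , a , b) (c′ , a′ , b′) →
  c *ℤ c′ , zipWith _+_ a a′ , zipWith _+_ b b′

∑ : List (Poly n) → Poly n
∑ = foldr _⊕_ 𝟘

∏ : List (Poly n) → Poly n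
∏ = foldr _⊗_ 𝟙

encodeLit : Literal n → Poly n
encodeLit (pos j) = x̄[ j ]
encodeLit (neg j) = x[ j ]

e : Clause n → Poly n
e C = ∏ (map encodeLit (literals (lits C)))

------------------------------------------------------------------------
-- SubCubeSums

SubCubeSums : Formula n → Formula n → Set
SubCubeSums F G = ∀ α → viol F α ≡ 1 + viol G α

combinatorialSize : Formula n → ℕ
combinatorialSize G = length G

axiomMultiple : (Fin n → Poly n) → Fin n → Poly n
axiomMultiple r j = r j ⊗ (𝟙 ⊖ x[ j ] ⊖ x̄[ j ])

SARepresentation : Formula n → Formula n → (Fin n → Poly n) → Set
SARepresentation {n} F G r =
  (⊖ ∑ (map e F)) ⊕ ∑ (map (axiomMultiple r) (allFin n)) ⊕ ∑ (map e G) ⊕ 𝟙 ≈ 𝟘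

representationSize : Formula n → Formula n → (Fin n → Poly n) → ℕ
representationSize {n} F G r =
  length F + length G + sum (map (λ j → ‖ axiomMultiple r j ‖₁) (allFin n))

-- The algebraic size is a minimum over representations; it is at most N iff
-- some representation has size at most N.
AlgebraicSizeAtMost : Formula n → Formula n → ℕ → Set
AlgebraicSizeAtMost {n} F G N =
  Σ[ r ∈ (Fin n → Poly n) ] SARepresentation F G r × representationSize F G r ≤ N

------------------------------------------------------------------------
-- Deterministic single-tape Turing machines

data Move : Set where
  left stay right : Move

-- Tape cells have type Maybe A, with nothing as the blank; a machine halts
-- when its transition function is undefined.
record TM (A : Set) : Set where
  field
    states : ℕ
    start  : Fin states
    δ      : Fin states → Maybe A → Maybe (Fin states × Maybe A × Move)

-- A two-way infinite tape: the cells left of the head (nearest first), the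
-- scanned cell and the cells right of it; all further cells are blank.
record Tape (A : Set) : Set where
  constructor tape
  field
    before : List (Maybe A)
    head   : Maybe A
    after  : List (Maybe A)

module _ {A : Set} where

  initialTape : List A → Tape A
  initialTape []      = tape [] nothing []
  initialTape (a ∷ w) = tape [] (just a) (map just w)

  write : Maybe A → Tape A → Tape A
  write a (tape ls _ rs) = tape ls a rs

  move : Move → Tape A → Tape A
  move left  (tape []       a rs)       = tape [] nothing (a ∷ rs)
  move left  (tape (l ∷ ls) a rs)       = tape ls l (a ∷ rs)
  move stay  t                          = t
  move right (tape ls       a [])       = tape (a ∷ ls) nothing []
  move right (tape ls       a (r ∷ rs)) = tape (a ∷ ls) r rs

  untilBlank : List (Maybe A) → List A
  untilBlank (just a ∷ cs)  = a ∷ untilBlank cs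
  untilBlank (nothing ∷ cs) = []
  untilBlank []             = []

  -- The word read from the scanned cell rightwards up to the first blank.
  output : Tape A → List A
  output (tape _ a rs) = untilBlank (a ∷ rs)

  Config : TM A → Set
  Config M = Fin (TM.states M) × Tape A

  next : (M : TM A) → Config M → Maybe (Config M)
  next M (q , t) with TM.δ M q (Tape.head t)
  ... | nothing           = nothing
  ... | just (q′ , a , d) = just (q′ , move d (write a t))

  initial : (M : TM A) → List A → Config M
  initial M w = TM.start M , initialTape w

  -- Halts M c k c′ : from c, the machine halts after exactly k steps in c′.
  data Halts (M : TM A) : Config M → ℕ → Config M → Set where
    stop : ∀ {c} → next M c ≡ nothing → Halts M c 0 c
    run  : ∀ {c c′ c″ k} → next M c ≡ just c′ → Halts M c′ k c″ → Halts M c (suc k) c″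

  PolynomialTime : TM A → Set
  PolynomialTime M = ∃[ d ] ∀ w → ∃[ k ] ∃[ c ]
    Halts M (initial M w) k c × k ≤ length w ^ d + d

  Computes : TM A → List A → List A → Set
  Computes M w v = ∃[ k ] ∃[ c ] Halts M (initial M w) k c × output (proj₂ c) ≡ v

------------------------------------------------------------------------
-- Words encoding formulas and sequences of formulas

data Symbol : Set where
  plus minus           : Symbol
  bit                  : Bit → Symbol
  endClause endFormula : Symbol

-- Variable indices are written in binary, least significant bit first.
wordVar : Fin n → List Symbol
wordVar x = map bit (proj₁ (toDigits 2 (toℕ x)))

wordLit : Literal n → List Symbol
wordLit (pos x) = plus ∷ wordVar x
wordLit (neg x) = minus ∷ wordVar x

wordClause : Clause n → List Symbol
wordClause C = concatMap wordLit (literals (lits C)) ++ [ endClause ]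

wordFormula : Formula n → List Symbol
wordFormula F = concatMap wordClause F ++ [ endFormula ]

wordRefutation : ∀ {F : Formula n} {s} → MaxResW F s → List Symbol
wordRefutation π = concatMap wordFormula (multisets π)

{-# OPTIONS --safe #-}

-- Replacing a clause C by its branches C ∨ x and C ∨ ¬x, where tautologous
-- branches are dropped, preserves viol, and it preserves the sum of the
-- encodings up to one monomial multiple of 1 − x − x̄. Weakening is one such
-- split. Resolution splits x ∨ A along B and ¬x ∨ B along A, which leaves the
-- two branches on x of A ∨ B, and then merges these. Hence G can be the last
-- multi-set of the refutation minus one empty clause.
--
-- A clause is empty iff its end marker follows the end marker of a clause or of
-- a formula, or the start of the tape. The machine goes to the end of the input
-- and returns shifting every symbol one cell to the left, until it meets such a
-- marker: there the shift overwrites the marker. It then goes on to the start of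
-- the last formula.

module Submission where

open import Defs
open import Data.Bool using (Bool; true; false; not; if_then_else_; _∧_; _∨_)
open import Data.Bool.Properties using (∧-zeroʳ)
open import Data.Empty.Irrelevant using (⊥-elim)
open import Data.Fin using (Fin; zero; suc; splitAt; _↑ˡ_; _↑ʳ_; #_)
import Data.Fin.Properties as Fin
open import Data.Fin.Subset using (Subset; ⁅_⁆; _∪_; _∩_; _∈_; _∉_) renaming (Nonempty to Inhabited)
open import Data.Fin.Subset.Properties
  using (_∈?_; nonempty?; ∉⊥; ∪-assoc; ∪-comm; ∪-identityˡ; x∈p∩q⁺; x∈p∩q⁻; q⊆p∪q; p⊆p∪q; x∈⁅x⁆; x∈p∪q⁺; x∈p∪q⁻; x∈⁅y⁆⇒x≡y)
open import Data.Integer using (ℤ; 0ℤ; 1ℤ; -1ℤ; ∣_∣) renaming (_+_ to _+ℤ_; _*_ to _*ℤ_; -_ to -ℤ_)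
import Data.Integer.Properties as ℤ
open import Data.Integer.Tactic.RingSolver using (solve-∀)
open import Data.List
  using (List; []; _∷_; [_]; _++_; _ʳ++_; map; concat; concatMap; foldr; filter; length; lookup; allFin; tabulate)
open import Data.List.Membership.Propositional using () renaming (_∈_ to _∈ˡ_)
open import Data.List.Membership.Propositional.Properties
  using (∈-lookup; ∈-++⁺ˡ; ∈-++⁺ʳ; ∈-++⁻; ∈-map⁺; ∈-map⁻; ∈-filter⁺; ∈-filter⁻; ∈-allFin)
open import Data.List.Properties
  using (mapMaybe-++; ++-identityʳ; ++-assoc; map-++; map-cong; map-tabulate; cartesianProductWith-distribʳ-++; ++-ʳ++; length-ʳ++; concatMap-++)
open import Data.List.Relation.Binary.Permutation.Propositional as ↭
  using (_↭_; ↭-refl; ↭-reflexive; ↭-sym; ↭-trans; ↭⇒↭ₛ; module PermutationReasoning)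
import Data.List.Relation.Binary.Permutation.Propositional.Properties as ↭
open import Data.List.Relation.Binary.Permutation.Setoid.Properties using (foldr-commMonoid)
open import Data.List.Relation.Unary.All as All using (All; []; _∷_)
import Data.List.Relation.Unary.All.Properties as All
open import Data.List.Relation.Unary.AllPairs using ([]; _∷_)
open import Data.List.Relation.Unary.Any using (here; there)
open import Data.List.Relation.Unary.Linked using (Linked; [-]; _∷_)
open import Data.List.Relation.Unary.Unique.DecPropositional.Properties using (deduplicate-!)
open import Data.List.Relation.Unary.Unique.Propositional using (Unique)
open import Data.Maybe as Maybe using (Maybe; just; nothing)
open import Data.Nat using (ℕ; zero; suc; _+_; _*_; _^_; _≤_; z≤n; s≤s)
open import Data.Nat.ListAction using (sum)
open import Data.Nat.ListAction.Properties using (sum-++; sum-↭)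
import Data.Nat.Properties as ℕ
import Data.Nat.Tactic.RingSolver as ℕ-Solver
open import Data.Product using (∃-syntax; Σ-syntax; _×_; _,_; proj₁; proj₂)
open import Data.Sum as Sum using (_⊎_; inj₁; inj₂)
open import Data.Vec as Vec using (Vec; []; _∷_; here; there; replicate; zipWith; _[_]≔_)
import Data.Vec.Properties as Vec
open import Function using (_∘_; mk⇔)
open import Relation.Binary.Construct.Closure.ReflexiveTransitive using (Star; ε; _◅_; _◅◅_)
open import Relation.Binary.PropositionalEquality
  using (_≡_; refl; sym; trans; cong; cong₂; subst; subst₂; setoid; module ≡-Reasoning)
open import Relation.Nullary using (¬_; does; yes; no; contradiction)
open import Relation.Nullary.Decidable using (does-⇔; dec-true; dec-false)

-- The identity is one of polynomials in 2n independent variables, without x² = x, so multiplying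
-- the encoding of C by 1 - x - x̄ yields encodings of clauses only if x does not occur in C. The
-- splits that a resolution step calls for need not be of that kind, since A and B may share
-- literals or clash. If x occurs in C, one branch is tautologous and the other is C itself, and
-- nothing has to be done; hence the index of a rewriting is a budget and not a count. Once a
-- refutation is a sequence of genuine splits and merges, the violation counts, the number of
-- clauses and the multipliers of the axioms all follow by induction on that sequence. The costs are
-- local: a split adds one clause, and a split or merge contributes three terms with coefficient ±1.
-- The removed empty clause is falsified by every assignment and encoded by the polynomial 1, which
-- accounts for the summand 1 in both definitions. The machine can be simple because the input
-- spells out every multi-set: its output is a contiguous part of the input with one symbol removed.

private
  variable
    n k l : ℕ
    F F′ G G′ H R : Formula n

-- Splitting clauses

Tautologous : LitSet n → Set
Tautologous L = Inhabited (positives L ∩ negatives L)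

toClause-tautologous : ∀ (L : LitSet n) → Tautologous L → toClause L ≡ nothing
toClause-tautologous L t with nonempty? (positives L ∩ negatives L)
... | yes _ = refl
... | no ¬t = contradiction t ¬t

toClause-lits : ∀ (C : Clause n) → toClause (lits C) ≡ just C
toClause-lits (clause L consistent) with nonempty? (positives L ∩ negatives L)
... | yes t = ⊥-elim (consistent t)
... | no _  = refl

toClause-view : ∀ (L : LitSet n) → Tautologous L ⊎ (∃[ C ] lits C ≡ L)
toClause-view L with nonempty? (positives L ∩ negatives L)
... | yes t = inj₁ t
... | no ¬t = inj₂ (clause L ¬t , refl)

nontautologies-∷ : ∀ {L : LitSet n} → Tautologous L → ∀ Ls → nontautologies (L ∷ Ls) ≡ nontautologies Ls
nontautologies-∷ {L = L} t Ls rewrite toClause-tautologous L t = refl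

nontautologies-lits : ∀ (C : Clause n) Ls → nontautologies (lits C ∷ Ls) ≡ C ∷ nontautologies Ls
nontautologies-lits C Ls rewrite toClause-lits C = refl

∪-absorbs-∈ : ∀ {x : Fin n} {p} → x ∈ p → ⁅ x ⁆ ∪ p ≡ p
∪-absorbs-∈ {p = _ ∷ p} here      = cong (_ ∷_) (∪-identityˡ p)
∪-absorbs-∈ {p = _ ∷ p} (there x∈p) = cong (_ ∷_) (∪-absorbs-∈ x∈p)

∪-left-comm : ∀ (p q r : Subset n) → p ∪ (q ∪ r) ≡ q ∪ (p ∪ r)
∪-left-comm p q r = trans (sym (∪-assoc p q r)) (trans (cong (_∪ r) (∪-comm p q)) (∪-assoc q p r))

insert-comm : ∀ (a b : Literal n) L → insert a (insert b L) ≡ insert b (insert a L)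
insert-comm (pos x) (pos y) (litSet p q) = cong (λ r → litSet r q) (∪-left-comm _ _ p)
insert-comm (pos x) (neg y) L            = refl
insert-comm (neg x) (pos y) L            = refl
insert-comm (neg x) (neg y) (litSet p q) = cong (litSet p) (∪-left-comm _ _ q)

tautologous-insert : ∀ (a : Literal n) L → Tautologous L → Tautologous (insert a L)
tautologous-insert (pos x) (litSet p q) (y , y∈) =
  let y∈p , y∈q = x∈p∩q⁻ p q y∈ in y , x∈p∩q⁺ (q⊆p∪q _ p y∈p , y∈q)
tautologous-insert (neg x) (litSet p q) (y , y∈) =
  let y∈p , y∈q = x∈p∩q⁻ p q y∈ in y , x∈p∩q⁺ (y∈p , q⊆p∪q _ q y∈q)

pos∈⇒tautologous : ∀ {x} (L : LitSet n) → x ∈ positives L → Tautologous (insert (neg x) L)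
pos∈⇒tautologous {x = x} L x∈ = x , x∈p∩q⁺ (x∈ , p⊆p∪q _ (x∈⁅x⁆ x))

neg∈⇒tautologous : ∀ {x} (L : LitSet n) → x ∈ negatives L → Tautologous (insert (pos x) L)
neg∈⇒tautologous {x = x} L x∈ = x , x∈p∩q⁺ (p⊆p∪q _ (x∈⁅x⁆ x) , x∈)

-- A genuine split, on a variable absent from `C`. The absence keeps all exponents at most 1 when
-- the encoding of `C` is multiplied by x or x̄.
record Splits {n} (x : Fin n) (C C⁺ C⁻ : Clause n) : Set where
  field
    ∉positives : x ∉ positives (lits C)
    ∉negatives : x ∉ negatives (lits C)
    lits⁺      : lits C⁺ ≡ insert (pos x) (lits C)
    lits⁻      : lits C⁻ ≡ insert (neg x) (lits C)

open Splits

-- The index bounds the number of splits and merges: `permute` accepts any `k`, so a degenerate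
-- split can spend its budget without changing anything. Splits and merges act at the front only;
-- other positions are reached by permuting.
data Rewrites {n} : ℕ → Formula n → Formula n → Set where
  permute : F ↭ G → Rewrites k F G
  split   : ∀ {x C C⁺ C⁻} → Splits x C C⁺ C⁻ → Rewrites 1 (C ∷ R) (C⁺ ∷ C⁻ ∷ R)
  merge   : ∀ {x C C⁺ C⁻} → Splits x C C⁺ C⁻ → Rewrites 1 (C⁺ ∷ C⁻ ∷ R) (C ∷ R)
  _then_  : Rewrites k F G → Rewrites l G H → Rewrites (k + l) F H

infixr 4 _then_

permuteˡ : F ↭ G → Rewrites k G H → Rewrites k F H
permuteˡ p r = permute {k = 0} p then r

permuteʳ : Rewrites k F G → G ↭ H → Rewrites k F H
permuteʳ r p = subst (λ k → Rewrites k _ _) (ℕ.+-identityʳ _) (r then permute {k = 0} p)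

insert-pos-consistent : ∀ {x} (C : Clause n) → x ∉ negatives (lits C) → Nontautologous (insert (pos x) (lits C))
insert-pos-consistent {x = x} (clause (litSet p q) consistent) x∉q (y , y∈) with x∈p∩q⁻ (⁅ x ⁆ ∪ p) q y∈
... | y∈x∪p , y∈q with x∈p∪q⁻ ⁅ x ⁆ p y∈x∪p
... | inj₁ y∈x = x∉q (subst (_∈ q) (x∈⁅y⁆⇒x≡y x y∈x) y∈q)
... | inj₂ y∈p = ⊥-elim (consistent (y , x∈p∩q⁺ (y∈p , y∈q)))

insert-neg-consistent : ∀ {x} (C : Clause n) → x ∉ positives (lits C) → Nontautologous (insert (neg x) (lits C))
insert-neg-consistent {x = x} (clause (litSet p q) consistent) x∉p (y , y∈) with x∈p∩q⁻ p (⁅ x ⁆ ∪ q) y∈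
... | y∈p , y∈x∪q with x∈p∪q⁻ ⁅ x ⁆ q y∈x∪q
... | inj₁ y∈x = x∉p (subst (_∈ p) (x∈⁅y⁆⇒x≡y x y∈x) y∈p)
... | inj₂ y∈q = ⊥-elim (consistent (y , x∈p∩q⁺ (y∈p , y∈q)))

branches : Fin n → LitSet n → Formula n
branches x L = nontautologies (insert (pos x) L ∷ insert (neg x) L ∷ [])

-- Tautologous branches vanish, leaving the clause itself.
branches-cases : ∀ x (C : Clause n) →
                 branches x (lits C) ≡ [ C ] ⊎
                 (∃[ C⁺ ] ∃[ C⁻ ] Splits x C C⁺ C⁻ × branches x (lits C) ≡ C⁺ ∷ C⁻ ∷ [])
branches-cases x C@(clause L@(litSet p q) _) with x ∈? p | x ∈? q
... | yes x∈p | _ = inj₁ (begin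
  nontautologies (litSet (⁅ x ⁆ ∪ p) q ∷ insert (neg x) L ∷ [])
    ≡⟨ cong (λ r → nontautologies (litSet r q ∷ insert (neg x) L ∷ [])) (∪-absorbs-∈ x∈p) ⟩
  nontautologies (L ∷ insert (neg x) L ∷ [])
    ≡⟨ nontautologies-lits C (insert (neg x) L ∷ []) ⟩
  C ∷ nontautologies [ insert (neg x) L ]
    ≡⟨ cong (C ∷_) (nontautologies-∷ (pos∈⇒tautologous L x∈p) []) ⟩
  [ C ] ∎)
  where open ≡-Reasoning
... | no _ | yes x∈q = inj₁ (begin
  nontautologies (insert (pos x) L ∷ litSet p (⁅ x ⁆ ∪ q) ∷ [])
    ≡⟨ nontautologies-∷ (neg∈⇒tautologous L x∈q) (litSet p (⁅ x ⁆ ∪ q) ∷ []) ⟩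
  nontautologies [ litSet p (⁅ x ⁆ ∪ q) ]
    ≡⟨ cong (λ r → nontautologies [ litSet p r ]) (∪-absorbs-∈ x∈q) ⟩
  nontautologies [ L ]
    ≡⟨ nontautologies-lits C [] ⟩
  [ C ] ∎)
  where open ≡-Reasoning
... | no x∉p | no x∉q = inj₂ (C⁺ , C⁻ ,
  record { ∉positives = x∉p ; ∉negatives = x∉q ; lits⁺ = refl ; lits⁻ = refl } ,
  trans (nontautologies-lits C⁺ (lits C⁻ ∷ [])) (cong (C⁺ ∷_) (nontautologies-lits C⁻ [])))
  where
  C⁺ = clause (insert (pos x) L) (insert-pos-consistent C x∉q)
  C⁻ = clause (insert (neg x) L) (insert-neg-consistent C x∉p)

branches-tautologous : ∀ x {L : LitSet n} → Tautologous L → branches x L ≡ []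
branches-tautologous x {L} t = trans
  (nontautologies-∷ (tautologous-insert (pos x) L t) (insert (neg x) L ∷ []))
  (nontautologies-∷ (tautologous-insert (neg x) L t) [])

-- Three cases: a tautologous `L`, which arises when the resolved clauses clash, leaves both sides
-- empty; if x occurs in the clause, the surviving branch is the clause itself; otherwise the split
-- is genuine.
branch : ∀ x (L : LitSet n) → Rewrites 1 (nontautologies [ L ]) (branches x L)
branch x L with toClause-view L
... | inj₁ t = permute (↭-reflexive (trans (nontautologies-∷ t []) (sym (branches-tautologous x t))))
... | inj₂ (C , refl) with branches-cases x C
... | inj₁ eq = permute (↭-reflexive (trans (nontautologies-lits C []) (sym eq)))
... | inj₂ (C⁺ , C⁻ , splits , eq) = subst₂ (Rewrites 1) (sym (nontautologies-lits C [])) (sym eq) (split splits)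

unbranch : ∀ x (L : LitSet n) → Rewrites 1 (branches x L) (nontautologies [ L ])
unbranch x L with toClause-view L
... | inj₁ t = permute (↭-reflexive (trans (branches-tautologous x t) (sym (nontautologies-∷ t []))))
... | inj₂ (C , refl) with branches-cases x C
... | inj₁ eq = permute (↭-reflexive (trans eq (sym (nontautologies-lits C []))))
... | inj₂ (C⁺ , C⁻ , splits , eq) = subst₂ (Rewrites 1) (sym eq) (sym (nontautologies-lits C [])) (merge splits)

branchLit : ∀ b (L : LitSet n) →
            Rewrites 1 (nontautologies [ L ]) (nontautologies (insert b L ∷ insert (complement b) L ∷ []))
branchLit (pos x) L = branch x L
branchLit (neg x) L = permuteʳ (branch x L)
  (↭.mapMaybe-↭ toClause (↭.swap (insert (pos x) L) (insert (neg x) L) (↭-refl {x = []})))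

++⁺-Rewrites : ∀ R → Rewrites k F G → Rewrites k (F ++ R) (G ++ R)
++⁺-Rewrites R (permute p) = permute (↭.++⁺ʳ R p)
++⁺-Rewrites R (split s)   = split s
++⁺-Rewrites R (merge s)   = merge s
++⁺-Rewrites R (r then r′) = ++⁺-Rewrites R r then ++⁺-Rewrites R r′

_++-Rewrites_ : Rewrites k F G → Rewrites l F′ G′ → Rewrites (k + l) (F ++ F′) (G ++ G′)
_++-Rewrites_ {F = F} {G = G} {F′ = F′} {G′ = G′} r r′ =
  ++⁺-Rewrites F′ r then permuteˡ (↭.++-comm G F′) (permuteʳ (++⁺-Rewrites G r′) (↭.++-comm G′ G))

-- Accumulates in the same order as `chain`: this is the prefix that `chain` has built up when its
-- list is exhausted.
insertAll : LitSet n → List (Literal n) → LitSet n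
insertAll L []       = L
insertAll L (b ∷ bs) = insertAll (insert b L) bs

nontautologies-++ : ∀ (Ls Ms : List (LitSet n)) → nontautologies (Ls ++ Ms) ≡ nontautologies Ls ++ nontautologies Ms
nontautologies-++ = mapMaybe-++ toClause

-- Splitting on `b` puts aside the branch with the complement of `b`, which is the next member of
-- the chain, and goes on with the other branch. Each literal costs one split.
chain-rewrites : ∀ (L : LitSet n) bs →
                 Rewrites (length bs) (nontautologies [ L ]) (nontautologies (insertAll L bs ∷ chain L bs))
chain-rewrites L []       = permute ↭-refl
chain-rewrites L (b ∷ bs) = branchLit b L then permuteˡ
  (↭-reflexive (nontautologies-++ [ L⁺ ] [ L⁻ ]))
  (permuteʳ (++⁺-Rewrites (nontautologies [ L⁻ ]) (chain-rewrites L⁺ bs))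
    (↭-trans
      (↭-reflexive (sym (nontautologies-++ (insertAll L⁺ bs ∷ chain L⁺ bs) [ L⁻ ])))
      (↭.mapMaybe-↭ toClause (↭.prep (insertAll L⁺ bs) (↭.++-comm (chain L⁺ bs) [ L⁻ ])))))
  where
  L⁺ = insert b L
  L⁻ = insert (complement b) L

insertAll-insert : ∀ a (L : LitSet n) bs → insertAll (insert a L) bs ≡ insert a (insertAll L bs)
insertAll-insert a L []       = refl
insertAll-insert a L (b ∷ bs) =
  trans (cong (λ M → insertAll M bs) (insert-comm b a L)) (insertAll-insert a (insert b L) bs)

insertAll-⋁ : ∀ (as bs : List (Literal n)) → insertAll (⋁ as) bs ≡ ⋁ (as ++ bs)
insertAll-⋁ []       []       = refl
insertAll-⋁ []       (b ∷ bs) = trans (insertAll-insert b ∅ bs) (cong (insert b) (insertAll-⋁ [] bs))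
insertAll-⋁ (a ∷ as) bs       = trans (insertAll-insert a (⋁ as) bs) (cong (insert a) (insertAll-⋁ as bs))

-- The counterpart of `insertAll-⋁` for the second antecedent: extending B by A yields the same set
-- as extending A by B, so the two chains end in branches of one clause and these can be merged.
insertAll-⋁ʳ : ∀ (as bs : List (Literal n)) → insertAll (⋁ bs) as ≡ ⋁ (as ++ bs)
insertAll-⋁ʳ []       bs = refl
insertAll-⋁ʳ (a ∷ as) bs = trans (insertAll-insert a (⋁ bs) as) (cong (insert a) (insertAll-⋁ʳ as bs))

-- Splitting x ∨ A along B and ¬x ∨ B along A leaves the two branches on x of A ∨ B.
resolution-rewrites : ∀ x (as bs : List (Literal n)) →
  Rewrites (length bs + length as + 1)
           (nontautologies (⋁ (pos x ∷ as) ∷ ⋁ (neg x ∷ bs) ∷ []))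
           (nontautologies (resolutionConsequents x as bs))
resolution-rewrites {n} x as bs = permuteˡ
  (↭-reflexive (nontautologies-++ [ P ] [ Q ]))
  (chain-rewrites P bs ++-Rewrites chain-rewrites Q as then
   permuteˡ regroup (permuteʳ (++⁺-Rewrites (nontautologies rest) (unbranch x M))
     (↭-reflexive (sym (nontautologies-++ [ M ] rest)))))
  where
  P Q M : LitSet n
  P = ⋁ (pos x ∷ as)
  Q = ⋁ (neg x ∷ bs)
  M = ⋁ (as ++ bs)
  rest : List (LitSet n)
  rest = chain P bs ++ chain Q as
  P+ : insertAll P bs ≡ insert (pos x) M
  P+ = trans (insertAll-insert (pos x) (⋁ as) bs) (cong (insert (pos x)) (insertAll-⋁ as bs))
  Q+ : insertAll Q as ≡ insert (neg x) M
  Q+ = trans (insertAll-insert (neg x) (⋁ bs) as) (cong (insert (neg x)) (insertAll-⋁ʳ as bs))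
  regroup : nontautologies (insertAll P bs ∷ chain P bs) ++ nontautologies (insertAll Q as ∷ chain Q as) ↭
            branches x M ++ nontautologies rest
  regroup = begin
    nontautologies (insertAll P bs ∷ chain P bs) ++ nontautologies (insertAll Q as ∷ chain Q as)
      ≡⟨ nontautologies-++ (insertAll P bs ∷ chain P bs) _ ⟨
    nontautologies (insertAll P bs ∷ chain P bs ++ insertAll Q as ∷ chain Q as)
      ↭⟨ ↭.mapMaybe-↭ toClause (↭.prep _ (↭.shift _ (chain P bs) (chain Q as))) ⟩
    nontautologies (insertAll P bs ∷ insertAll Q as ∷ rest)
      ≡⟨ cong₂ (λ L N → nontautologies (L ∷ N ∷ rest)) P+ Q+ ⟩
    nontautologies (insert (pos x) M ∷ insert (neg x) M ∷ rest)
      ≡⟨ nontautologies-++ (insert (pos x) M ∷ insert (neg x) M ∷ []) rest ⟩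
    branches x M ++ nontautologies rest ∎
    where open PermutationReasoning

-- Number of rewriting steps in a refutation

unique-length : ∀ {A : Set} {m} (f : A → Fin m) → (∀ {x y} → f x ≡ f y → x ≡ y) →
                ∀ {xs} → Unique xs → length xs ≤ m
unique-length f f-injective {xs} unique =
  Fin.injective⇒≤ (λ {i} {j} eq → lookup-injective unique i j (f-injective eq))
  where
  lookup-injective : ∀ {xs} → Unique xs → ∀ i j → lookup xs i ≡ lookup xs j → i ≡ j
  lookup-injective (_ ∷ _) zero zero eq = refl
  lookup-injective {xs = _ ∷ xs} (x∉ ∷ _) zero (suc j) eq = contradiction eq (All.lookup x∉ (∈-lookup j))
  lookup-injective {xs = _ ∷ xs} (x∉ ∷ _) (suc i) zero eq = contradiction (sym eq) (All.lookup x∉ (∈-lookup i))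
  lookup-injective (_ ∷ unique) (suc i) (suc j) eq = cong suc (lookup-injective unique i j eq)

literalIndex : Literal n → Fin (n + n)
literalIndex {n} (pos x) = x ↑ˡ n
literalIndex {n} (neg x) = n ↑ʳ x

literalIndex-injective : ∀ {a b : Literal n} → literalIndex a ≡ literalIndex b → a ≡ b
literalIndex-injective {n} {pos x} {pos y} eq = cong pos (Fin.↑ˡ-injective n x y eq)
literalIndex-injective {n} {neg x} {neg y} eq = cong neg (Fin.↑ʳ-injective n x y eq)
literalIndex-injective {n} {pos x} {neg y} eq
  with () ← trans (sym (Fin.splitAt-↑ˡ n x n)) (trans (cong (splitAt n) eq) (Fin.splitAt-↑ʳ n n y))
literalIndex-injective {n} {neg x} {pos y} eq
  with () ← trans (sym (Fin.splitAt-↑ʳ n n x)) (trans (cong (splitAt n) eq) (Fin.splitAt-↑ˡ n y n))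

unique-literals : ∀ {as : List (Literal n)} → Unique as → length as ≤ n + n
unique-literals = unique-length literalIndex literalIndex-injective

-- Resolution costs two chains and one merge. Since `pos x ∷ as` and `neg x ∷ bs` are duplicate-free
-- lists of literals, each has length at most 2n, and together they exceed the cost by one.
step-rewrites : F ⟶ F′ → ∃[ k ] k ≤ 4 * n × Rewrites {n} k F F′
step-rewrites {n = n} (resolve x as bs unique-as unique-bs C D R eqC eqD F↭ F′↭) =
  length bs + length as + 1 , bound ,
  permuteˡ F↭ (permuteʳ (++⁺-Rewrites R
    (permuteˡ (↭-reflexive antecedents) (resolution-rewrites x as bs))) (↭-sym F′↭))
  where
  antecedents : C ∷ D ∷ [] ≡ nontautologies (⋁ (pos x ∷ as) ∷ ⋁ (neg x ∷ bs) ∷ [])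
  antecedents = begin
    C ∷ D ∷ []                             ≡⟨ cong (C ∷_) (nontautologies-lits D []) ⟨
    C ∷ nontautologies (lits D ∷ [])       ≡⟨ nontautologies-lits C (lits D ∷ []) ⟨
    nontautologies (lits C ∷ lits D ∷ [])  ≡⟨ cong₂ (λ L M → nontautologies (L ∷ M ∷ [])) eqC eqD ⟩
    nontautologies (⋁ (pos x ∷ as) ∷ ⋁ (neg x ∷ bs) ∷ []) ∎
    where open ≡-Reasoning
  bound : length bs + length as + 1 ≤ 4 * n
  bound = begin
    length bs + length as + 1          ≡⟨ regroup (length as) (length bs) ⟩
    length bs + suc (length as)        ≤⟨ ℕ.+-monoˡ-≤ (suc (length as)) (ℕ.n≤1+n (length bs)) ⟩
    suc (length bs) + suc (length as)  ≤⟨ ℕ.+-mono-≤ (unique-literals unique-bs) (unique-literals unique-as) ⟩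
    n + n + (n + n)                    ≡⟨ double n ⟩
    4 * n                              ∎
    where
    open ℕ.≤-Reasoning
    regroup : ∀ a b → b + a + 1 ≡ b + suc a
    regroup = ℕ-Solver.solve-∀
    double : ∀ n → n + n + (n + n) ≡ 4 * n
    double = ℕ-Solver.solve-∀
-- The variable `x` exists, so n is positive and a single split is within 4n.
step-rewrites {n = suc n} (weaken x C R F↭ F′↭) =
  1 , s≤s z≤n ,
  permuteˡ F↭ (permuteʳ (++⁺-Rewrites R
    (permuteˡ (↭-reflexive (sym (nontautologies-lits C []))) (branch x (lits C)))) (↭-sym F′↭))

final : ∀ {F : Formula n} {s} → MaxResW F s → Formula n
final {F = F} (done _) = F
final (step _ π)       = final π

final-contains-empty : ∀ {F : Formula n} {s} (π : MaxResW F s) → ContainsEmptyClause (final π)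
final-contains-empty (done empty) = empty
final-contains-empty (step _ π)   = final-contains-empty π

multisets-final : ∀ {F : Formula n} {s} (π : MaxResW F s) → ∃[ Φ ] multisets π ≡ Φ ++ [ final π ]
multisets-final (done _) = [] , refl
multisets-final {F = F} (step _ π) = let Φ , eq = multisets-final π in F ∷ Φ , cong (F ∷_) eq

refutation-rewrites : ∀ {F : Formula n} {s} (π : MaxResW F s) → ∃[ k ] k ≤ s * (4 * n) × Rewrites k F (final π)
refutation-rewrites (done _)   = 0 , z≤n , permute ↭-refl
refutation-rewrites (step σ π) =
  let k , k≤ , r  = step-rewrites σ
      l , l≤ , r′ = refutation-rewrites π
  in k + l , ℕ.+-mono-≤ k≤ l≤ , (r then r′)

-- Violations

infix 4 _∈ᴸ_
-- Reads membership off the two subsets, where the effect of `insert` is visible; the filtered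
-- enumeration `literals` hides it.
_∈ᴸ_ : Literal n → LitSet n → Set
pos x ∈ᴸ L = x ∈ positives L
neg x ∈ᴸ L = x ∈ negatives L

∈ᴸ⇒∈literals : ∀ {L : LitSet n} a → a ∈ᴸ L → a ∈ˡ literals L
∈ᴸ⇒∈literals (pos x) x∈ = ∈-++⁺ˡ (∈-map⁺ pos (∈-filter⁺ (_∈? _) (∈-allFin x) x∈))
∈ᴸ⇒∈literals (neg x) x∈ = ∈-++⁺ʳ _ (∈-map⁺ neg (∈-filter⁺ (_∈? _) (∈-allFin x) x∈))

∈literals⇒∈ᴸ : ∀ (L : LitSet n) {a} → a ∈ˡ literals L → a ∈ᴸ L
∈literals⇒∈ᴸ {n} L a∈ with ∈-++⁻ (map pos (filter (_∈? positives L) (allFin n))) a∈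
... | inj₁ a∈⁺ with x , x∈ , refl ← ∈-map⁻ pos a∈⁺ = proj₂ (∈-filter⁻ (_∈? positives L) {xs = allFin n} x∈)
... | inj₂ a∈⁻ with x , x∈ , refl ← ∈-map⁻ neg a∈⁻ = proj₂ (∈-filter⁻ (_∈? negatives L) {xs = allFin n} x∈)

∈ᴸ-insert-self : ∀ a (L : LitSet n) → a ∈ᴸ insert a L
∈ᴸ-insert-self (pos x) L = x∈p∪q⁺ (inj₁ (x∈⁅x⁆ x))
∈ᴸ-insert-self (neg x) L = x∈p∪q⁺ (inj₁ (x∈⁅x⁆ x))

∈ᴸ-insert⁺ : ∀ a {b} (L : LitSet n) → b ∈ᴸ L → b ∈ᴸ insert a L
∈ᴸ-insert⁺ (pos x) {pos y} L y∈ = x∈p∪q⁺ (inj₂ y∈)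
∈ᴸ-insert⁺ (pos x) {neg y} L y∈ = y∈
∈ᴸ-insert⁺ (neg x) {pos y} L y∈ = y∈
∈ᴸ-insert⁺ (neg x) {neg y} L y∈ = x∈p∪q⁺ (inj₂ y∈)

∈ᴸ-insert⁻ : ∀ a b (L : LitSet n) → b ∈ᴸ insert a L → b ≡ a ⊎ b ∈ᴸ L
∈ᴸ-insert⁻ (pos x) (pos y) L y∈ with x∈p∪q⁻ ⁅ x ⁆ (positives L) y∈
... | inj₁ y∈x = inj₁ (cong pos (x∈⁅y⁆⇒x≡y x y∈x))
... | inj₂ y∈p = inj₂ y∈p
∈ᴸ-insert⁻ (pos x) (neg y) L y∈ = inj₂ y∈
∈ᴸ-insert⁻ (neg x) (pos y) L y∈ = inj₂ y∈
∈ᴸ-insert⁻ (neg x) (neg y) L y∈ with x∈p∪q⁻ ⁅ x ⁆ (negatives L) y∈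
... | inj₁ y∈x = inj₁ (cong neg (x∈⁅y⁆⇒x≡y x y∈x))
... | inj₂ y∈q = inj₂ y∈q

falsified-insert⁻ : ∀ α {C D : Clause n} a → lits D ≡ insert a (lits C) →
                    Falsified α D → value α a ≡ false × Falsified α C
falsified-insert⁻ α {C} a refl falsified =
  All.lookup falsified (∈ᴸ⇒∈literals a (∈ᴸ-insert-self a (lits C))) ,
  All.tabulate λ {b} b∈ → All.lookup falsified
    (∈ᴸ⇒∈literals b (∈ᴸ-insert⁺ a (lits C) (∈literals⇒∈ᴸ (lits C) b∈)))

falsified-insert⁺ : ∀ α {C D : Clause n} a → lits D ≡ insert a (lits C) →
                    value α a ≡ false → Falsified α C → Falsified α D
falsified-insert⁺ α {C} {D} a refl va falsified = All.tabulate check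
  where
  check : ∀ {b} → b ∈ˡ literals (insert a (lits C)) → value α b ≡ false
  check {b} b∈ with ∈ᴸ-insert⁻ a b (lits C) (∈literals⇒∈ᴸ (insert a (lits C)) b∈)
  ... | inj₁ refl = va
  ... | inj₂ b∈C  = All.lookup falsified (∈ᴸ⇒∈literals b b∈C)

bit⟨_⟩ : Bool → ℕ
bit⟨ b ⟩ = if b then 1 else 0

viol-∷ : ∀ (C : Clause n) F α → viol (C ∷ F) α ≡ bit⟨ does (falsified? α C) ⟩ + viol F α
viol-∷ C F α with does (falsified? α C)
... | true  = refl
... | false = refl

-- The assignment satisfies exactly one of x and ¬x. The branch with that literal is not falsified,
-- and the other branch is falsified exactly when `C` is.
falsified-splits : ∀ {x} {C C⁺ C⁻ : Clause n} → Splits x C C⁺ C⁻ → ∀ α →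
  bit⟨ does (falsified? α C) ⟩ ≡ bit⟨ does (falsified? α C⁺) ⟩ + bit⟨ does (falsified? α C⁻) ⟩
falsified-splits {x = x} {C} {C⁺} {C⁻} s α with α x in αx
... | true  = cong₂ (λ a b → bit⟨ a ⟩ + bit⟨ b ⟩)
  (sym (dec-false (falsified? α C⁺) λ f → contradiction (trans (sym αx) (proj₁ (from⁺ f))) λ ()))
  (does-⇔ (mk⇔ (falsified-insert⁺ α {C} {C⁻} (neg x) (lits⁻ s) (cong not αx)) (proj₂ ∘ from⁻))
         (falsified? α C) (falsified? α C⁻))
  where
  from⁺ = falsified-insert⁻ α {C} {C⁺} (pos x) (lits⁺ s)
  from⁻ = falsified-insert⁻ α {C} {C⁻} (neg x) (lits⁻ s)
... | false = trans (sym (ℕ.+-identityʳ _)) (cong₂ (λ a b → bit⟨ a ⟩ + bit⟨ b ⟩)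
  (does-⇔ (mk⇔ (falsified-insert⁺ α {C} {C⁺} (pos x) (lits⁺ s) αx) (proj₂ ∘ from⁺))
         (falsified? α C) (falsified? α C⁺))
  (sym (dec-false (falsified? α C⁻) λ f → contradiction (trans (sym (cong not αx)) (proj₁ (from⁻ f))) λ ())))
  where
  from⁺ = falsified-insert⁻ α {C} {C⁺} (pos x) (lits⁺ s)
  from⁻ = falsified-insert⁻ α {C} {C⁻} (neg x) (lits⁻ s)

viol-↭ : F ↭ G → ∀ (α : Assignment n) → viol F α ≡ viol G α
viol-↭ F↭G α = ↭.↭-length (↭.filter-↭ (falsified? α) F↭G)

viol-splits : ∀ {x} {C C⁺ C⁻ : Clause n} → Splits x C C⁺ C⁻ → ∀ R α → viol (C ∷ R) α ≡ viol (C⁺ ∷ C⁻ ∷ R) α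
viol-splits {C = C} {C⁺} {C⁻} s R α = begin
  viol (C ∷ R) α                                                ≡⟨ viol-∷ C R α ⟩
  bit⟨ does (falsified? α C) ⟩ + viol R α                       ≡⟨ cong (_+ viol R α) (falsified-splits s α) ⟩
  bit⟨ does (falsified? α C⁺) ⟩ + bit⟨ does (falsified? α C⁻) ⟩ + viol R α ≡⟨ ℕ.+-assoc bit⟨ does (falsified? α C⁺) ⟩ _ _ ⟩
  bit⟨ does (falsified? α C⁺) ⟩ + (bit⟨ does (falsified? α C⁻) ⟩ + viol R α)
    ≡⟨ cong (bit⟨ does (falsified? α C⁺) ⟩ +_) (viol-∷ C⁻ R α) ⟨
  bit⟨ does (falsified? α C⁺) ⟩ + viol (C⁻ ∷ R) α               ≡⟨ viol-∷ C⁺ (C⁻ ∷ R) α ⟨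
  viol (C⁺ ∷ C⁻ ∷ R) α                                          ∎
  where open ≡-Reasoning

viol-Rewrites : Rewrites k F G → ∀ (α : Assignment n) → viol F α ≡ viol G α
viol-Rewrites (permute p)       α = viol-↭ p α
viol-Rewrites (split {R = R} s) α = viol-splits s R α
viol-Rewrites (merge {R = R} s) α = sym (viol-splits s R α)
viol-Rewrites (r then r′)       α = trans (viol-Rewrites r α) (viol-Rewrites r′ α)

-- Only a split increases the number of clauses, and by one.
length-Rewrites : ∀ {F G : Formula n} → Rewrites k F G → length G ≤ length F + k
length-Rewrites (permute {k = k} p) = ℕ.≤-trans (ℕ.≤-reflexive (sym (↭.↭-length p))) (ℕ.m≤m+n _ k)
length-Rewrites (split {R = R} _)   = ℕ.≤-reflexive (ℕ.+-comm 1 (1 + length R))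
length-Rewrites (merge {R = R} _)   = ℕ.≤-trans (ℕ.n≤1+n _) (ℕ.m≤m+n _ 1)
length-Rewrites {F = F} (_then_ {k = k} {l = l} r r′) = ℕ.≤-trans (length-Rewrites r′)
  (ℕ.≤-trans (ℕ.+-monoˡ-≤ l (length-Rewrites r)) (ℕ.≤-reflexive (ℕ.+-assoc (length F) k l)))

literals-empty : ∀ {L : LitSet n} → L ≡ ∅ → literals L ≡ []
literals-empty {n} refl = none
  where
  none : literals (∅ {n}) ≡ []
  none with literals (∅ {n}) in eq
  ... | []    = refl
  ... | a ∷ _ = contradiction (∈literals⇒∈ᴸ ∅ (subst (a ∈ˡ_) (sym eq) (here refl))) (¬∈∅ a)
    where
    ¬∈∅ : ∀ a → ¬ a ∈ᴸ ∅ {n}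
    ¬∈∅ (pos x) = ∉⊥
    ¬∈∅ (neg x) = ∉⊥

falsified-empty : ∀ {C : Clause n} → literals (lits C) ≡ [] → ∀ α → does (falsified? α C) ≡ true
falsified-empty {C = C} eq α = dec-true (falsified? α C) (subst (All _) (sym eq) [])

-- Polynomials

exponents : List (Fin n) → Vec ℕ n
exponents = foldr (λ i v → zipWith _+_ (replicate _ 0 [ i ]≔ 1) v) (replicate _ 0)

indicator : Subset n → Vec ℕ n
indicator = Vec.map bit⟨_⟩

-- The components are swapped because a positive literal is encoded by its barred variable, whose
-- exponents come second.
monomial : LitSet n → Monomial n
monomial L = indicator (negatives L) , indicator (positives L)

∏-literals : ∀ (xs ys : List (Fin n)) →
             ∏ (map encodeLit (map pos xs ++ map neg ys)) ≡ [ 1ℤ , exponents ys , exponents xs ]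
∏-literals [] [] = refl
∏-literals [] (y ∷ ys) rewrite ∏-literals [] ys =
  cong (λ v → [ 1ℤ , exponents (y ∷ ys) , v ]) (Vec.zipWith-identityˡ ℕ.+-identityˡ _)
∏-literals (x ∷ xs) ys rewrite ∏-literals xs ys =
  cong (λ v → [ 1ℤ , v , exponents (x ∷ xs) ]) (Vec.zipWith-identityˡ ℕ.+-identityˡ _)

exponents-suc : ∀ (xs : List (Fin n)) → exponents (map suc xs) ≡ 0 ∷ exponents xs
exponents-suc []       = refl
exponents-suc (x ∷ xs) = cong (zipWith _+_ (0 ∷ (replicate _ 0 [ x ]≔ 1))) (exponents-suc xs)

filter-suc : ∀ s (p : Subset n) xs → filter (_∈? (s ∷ p)) (map suc xs) ≡ map suc (filter (_∈? p) xs)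
filter-suc s p []       = refl
filter-suc s p (x ∷ xs) with does (x ∈? p)
... | true  = cong (suc x ∷_) (filter-suc s p xs)
... | false = filter-suc s p xs

exponents-filter : ∀ (p : Subset n) → exponents (filter (_∈? p) (allFin n)) ≡ indicator p
exponents-filter []              = refl
exponents-filter {suc n} (s ∷ p) = trans
  (cong (λ xs → exponents (filter (_∈? (s ∷ p)) (zero ∷ xs))) (sym (map-tabulate (λ i → i) suc)))
  (by-head s)
  where
  tail : ∀ s → exponents (filter (_∈? (s ∷ p)) (map suc (allFin n))) ≡ 0 ∷ indicator p
  tail s = trans (cong exponents (filter-suc s p (allFin n)))
                 (trans (exponents-suc (filter (_∈? p) (allFin n))) (cong (0 ∷_) (exponents-filter p)))
  by-head : ∀ s → exponents (filter (_∈? (s ∷ p)) (zero ∷ map suc (allFin n))) ≡ indicator (s ∷ p)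
  by-head true  = trans (cong (zipWith _+_ (1 ∷ replicate _ 0)) (tail true))
                        (cong (1 ∷_) (Vec.zipWith-identityˡ ℕ.+-identityˡ _))
  by-head false = tail false

-- An equality of lists of terms and not just `≈`: every factor of the product is a single term with
-- coefficient 1. It can therefore be substituted inside `coeff` and `formalNorm` alike.
e-monomial : ∀ (C : Clause n) → e C ≡ [ 1ℤ , monomial (lits C) ]
e-monomial {n} C = trans
  (∏-literals (filter (_∈? positives (lits C)) (allFin n)) (filter (_∈? negatives (lits C)) (allFin n)))
  (cong₂ (λ a b → [ 1ℤ , a , b ]) (exponents-filter (negatives (lits C))) (exponents-filter (positives (lits C))))

-- If x were in `p`, the left side would have exponent 2 at x while the union is idempotent.
indicator-insert : ∀ {x} {p : Subset n} → x ∉ p →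
                   zipWith _+_ (indicator p) (replicate n 0 [ x ]≔ 1) ≡ indicator (⁅ x ⁆ ∪ p)
indicator-insert {x = zero}  {true ∷ p}  x∉p = contradiction here x∉p
indicator-insert {x = zero}  {false ∷ p} x∉p =
  cong (1 ∷_) (trans (Vec.zipWith-identityʳ ℕ.+-identityʳ _) (cong indicator (sym (∪-identityˡ p))))
indicator-insert {x = suc x} {s ∷ p}     x∉p = cong₂ _∷_ (ℕ.+-identityʳ _) (indicator-insert (x∉p ∘ there))

axiomPoly : Fin n → Poly n
axiomPoly j = 𝟙 ⊖ x[ j ] ⊖ x̄[ j ]

-- Multiplying by x adjoins the literal ¬x and multiplying by x̄ adjoins x, so `C⁻` comes before
-- `C⁺`. The scalar `c` is 1 for splits and -1 for merges.
axiom-splits : ∀ {x} {C C⁺ C⁻ : Clause n} → Splits x C C⁺ C⁻ → ∀ c →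
  [ c , monomial (lits C) ] ⊗ axiomPoly x ≡
  (c *ℤ 1ℤ , monomial (lits C)) ∷ (c *ℤ -1ℤ , monomial (lits C⁻)) ∷ (c *ℤ -1ℤ , monomial (lits C⁺)) ∷ []
axiom-splits s c with lits⁺ s | lits⁻ s
... | eq⁺ | eq⁻ rewrite eq⁺ | eq⁻ = cong₂ _∷_
  (cong (c *ℤ 1ℤ ,_) (cong₂ _,_ (Vec.zipWith-identityʳ ℕ.+-identityʳ _) (Vec.zipWith-identityʳ ℕ.+-identityʳ _)))
  (cong₂ _∷_
    (cong (c *ℤ -1ℤ ,_) (cong₂ _,_ (indicator-insert (∉negatives s)) (Vec.zipWith-identityʳ ℕ.+-identityʳ _)))
    (cong [_] (cong (c *ℤ -1ℤ ,_) (cong₂ _,_ (Vec.zipWith-identityʳ ℕ.+-identityʳ _) (indicator-insert (∉positives s))))))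

coeff-∷ : ∀ t (p : Poly n) m → coeff (t ∷ p) m ≡ coeff [ t ] m +ℤ coeff p m
coeff-∷ t p m with does (proj₂ t ≟ᴹ m)
... | true  = cong (_+ℤ coeff p m) (sym (ℤ.+-identityʳ (proj₁ t)))
... | false = sym (ℤ.+-identityˡ _)

coeff-++ : ∀ (p q : Poly n) m → coeff (p ++ q) m ≡ coeff p m +ℤ coeff q m
coeff-++ []      q m = sym (ℤ.+-identityˡ _)
coeff-++ (t ∷ p) q m = begin
  coeff (t ∷ p ++ q) m                        ≡⟨ coeff-∷ t (p ++ q) m ⟩
  coeff [ t ] m +ℤ coeff (p ++ q) m           ≡⟨ cong (coeff [ t ] m +ℤ_) (coeff-++ p q m) ⟩
  coeff [ t ] m +ℤ (coeff p m +ℤ coeff q m)   ≡⟨ ℤ.+-assoc (coeff [ t ] m) _ _ ⟨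
  coeff [ t ] m +ℤ coeff p m +ℤ coeff q m     ≡⟨ cong (_+ℤ coeff q m) (coeff-∷ t p m) ⟨
  coeff (t ∷ p) m +ℤ coeff q m                ∎
  where open ≡-Reasoning

coeff-↭ : ∀ {p q : Poly n} → p ↭ q → ∀ m → coeff p m ≡ coeff q m
coeff-↭ p↭q m = foldr-commMonoid (setoid ℤ) ℤ.+-0-isCommutativeMonoid
  (↭⇒↭ₛ (↭.map⁺ proj₁ (↭.filter-↭ (λ t → proj₂ t ≟ᴹ m) p↭q)))

coeff-neg : ∀ c (μ : Monomial n) m → coeff [ -ℤ c , μ ] m ≡ -ℤ coeff [ c , μ ] m
coeff-neg c μ m with does (μ ≟ᴹ m)
... | true  = trans (ℤ.+-identityʳ _) (cong -ℤ_ (sym (ℤ.+-identityʳ c)))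
... | false = refl

coeff-⊖ : ∀ (p : Poly n) m → coeff (⊖ p) m ≡ -ℤ coeff p m
coeff-⊖ []            m = refl
coeff-⊖ ((c , μ) ∷ p) m = begin
  coeff ((-ℤ c , μ) ∷ ⊖ p) m                  ≡⟨ coeff-∷ (-ℤ c , μ) (⊖ p) m ⟩
  coeff [ -ℤ c , μ ] m +ℤ coeff (⊖ p) m       ≡⟨ cong₂ _+ℤ_ (coeff-neg c μ m) (coeff-⊖ p m) ⟩
  -ℤ coeff [ c , μ ] m +ℤ -ℤ coeff p m        ≡⟨ ℤ.neg-distrib-+ (coeff [ c , μ ] m) (coeff p m) ⟨
  -ℤ (coeff [ c , μ ] m +ℤ coeff p m)         ≡⟨ cong -ℤ_ (coeff-∷ (c , μ) p m) ⟨
  -ℤ coeff ((c , μ) ∷ p) m                    ∎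
  where open ≡-Reasoning

-- Unlike ‖_‖₁, which it bounds, this norm does not collect coefficients, so it is additive.
formalNorm : Poly n → ℕ
formalNorm p = sum (map (λ t → ∣ proj₁ t ∣) p)

formalNorm-++ : ∀ (p q : Poly n) → formalNorm (p ++ q) ≡ formalNorm p + formalNorm q
formalNorm-++ p q = trans (cong sum (map-++ _ p q)) (sum-++ (map _ p) (map _ q))

formalNorm-↭ : ∀ {p q : Poly n} → p ↭ q → formalNorm p ≡ formalNorm q
formalNorm-↭ p↭q = sum-↭ (↭.map⁺ _ p↭q)

-- A term has a nonzero coefficient at most at its own monomial, and a duplicate-free list meets
-- that monomial at most once.
coeffs-term : ∀ c (μ : Monomial n) {ms} → Unique ms → sum (map (λ m → ∣ coeff [ c , μ ] m ∣) ms) ≤ ∣ c ∣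
coeffs-term c μ []                           = z≤n
coeffs-term c μ {m ∷ ms} (m∉ms ∷ unique) with μ ≟ᴹ m
... | no _     = coeffs-term c μ unique
... | yes refl = ℕ.≤-reflexive (trans (cong₂ _+_ (cong ∣_∣ (ℤ.+-identityʳ c)) (rest m∉ms)) (ℕ.+-identityʳ _))
  where
  rest : ∀ {ms} → All (λ m′ → ¬ μ ≡ m′) ms → sum (map (λ m → ∣ coeff [ c , μ ] m ∣) ms) ≡ 0
  rest []                      = refl
  rest (_∷_ {x = m′} μ≢m′ all) with μ ≟ᴹ m′
  ... | yes eq = contradiction eq μ≢m′
  ... | no _   = rest all

sum-map-+ : ∀ {A : Set} (f g : A → ℕ) xs → sum (map (λ x → f x + g x) xs) ≡ sum (map f xs) + sum (map g xs)
sum-map-+ f g []       = refl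
sum-map-+ f g (x ∷ xs) =
  trans (cong (f x + g x +_) (sum-map-+ f g xs)) (interchange (f x) (g x) (sum (map f xs)) (sum (map g xs)))
  where
  interchange : ∀ a b c d → a + b + (c + d) ≡ a + c + (b + d)
  interchange = ℕ-Solver.solve-∀

sum-map-mono : ∀ {A : Set} {f g : A → ℕ} → (∀ x → f x ≤ g x) → ∀ xs → sum (map f xs) ≤ sum (map g xs)
sum-map-mono f≤g []       = z≤n
sum-map-mono f≤g (x ∷ xs) = ℕ.+-mono-≤ (f≤g x) (sum-map-mono f≤g xs)

-- The triangle inequality, one term at a time. The list `ms` is arbitrary because the monomials
-- occurring in `p` change along the induction.
coeffs≤formalNorm : ∀ (p : Poly n) {ms} → Unique ms → sum (map (λ m → ∣ coeff p m ∣) ms) ≤ formalNorm p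
coeffs≤formalNorm [] {ms} _ = ℕ.≤-reflexive (zeros ms)
  where
  zeros : ∀ {A : Set} (xs : List A) → sum (map (λ _ → 0) xs) ≡ 0
  zeros []       = refl
  zeros (_ ∷ xs) = zeros xs
coeffs≤formalNorm (t ∷ p) {ms} unique = begin
  sum (map (λ m → ∣ coeff (t ∷ p) m ∣) ms)
    ≤⟨ sum-map-mono (λ m → ℕ.≤-trans (ℕ.≤-reflexive (cong ∣_∣ (coeff-∷ t p m)))
                                     (ℤ.∣i+j∣≤∣i∣+∣j∣ (coeff [ t ] m) _)) ms ⟩
  sum (map (λ m → ∣ coeff [ t ] m ∣ + ∣ coeff p m ∣) ms)
    ≡⟨ sum-map-+ _ _ ms ⟩
  sum (map (λ m → ∣ coeff [ t ] m ∣) ms) + sum (map (λ m → ∣ coeff p m ∣) ms)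
    ≤⟨ ℕ.+-mono-≤ (coeffs-term (proj₁ t) (proj₂ t) unique) (coeffs≤formalNorm p unique) ⟩
  formalNorm (t ∷ p) ∎
  where open ℕ.≤-Reasoning

norm≤formalNorm : ∀ (p : Poly n) → ‖ p ‖₁ ≤ formalNorm p
norm≤formalNorm p = coeffs≤formalNorm p (deduplicate-! _≟ᴹ_ (map proj₂ p))

norms≤formalNorm : ∀ (ps : Fin k → Poly n) js → sum (map (λ j → ‖ ps j ‖₁) js) ≤ formalNorm (∑ (map ps js))
norms≤formalNorm ps []       = z≤n
norms≤formalNorm ps (j ∷ js) = ℕ.≤-trans
  (ℕ.+-mono-≤ (norm≤formalNorm (ps j)) (norms≤formalNorm ps js))
  (ℕ.≤-reflexive (sym (formalNorm-++ (ps j) _)))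

single : ∀ {A : Set} → Fin k → List A → Fin k → List A
single zero    p zero    = p
single zero    p (suc _) = []
single (suc x) p zero    = []
single (suc x) p (suc j) = single x p j

-- Stated for an arbitrary `h` because the induction replaces `h` by `h ∘ suc`; it is applied to
-- multiplication by the j-th axiom, which maps the zero polynomial to itself.
concat-single : ∀ {A B : Set} (h : Fin k → List A → List B) → (∀ j → h j [] ≡ []) →
                ∀ x p → concat (tabulate (λ j → h j (single x p j))) ≡ h x p
concat-single h h[] zero p = trans (cong (h zero p ++_) (empties (λ j → h (suc j) []) (h[] ∘ suc))) (++-identityʳ _)
  where
  empties : ∀ {k} {B : Set} (f : Fin k → List B) → (∀ j → f j ≡ []) → concat (tabulate f) ≡ []
  empties {zero}  f f[] = refl
  empties {suc k} f f[] = cong₂ _++_ (f[] zero) (empties (f ∘ suc) (f[] ∘ suc))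
concat-single h h[] (suc x) p = cong₂ _++_ (h[] zero) (concat-single (h ∘ suc) (h[] ∘ suc) x p)

concat-map-++ : ∀ {A B : Set} (f g : A → List B) xs →
                concat (map (λ x → f x ++ g x) xs) ↭ concat (map f xs) ++ concat (map g xs)
concat-map-++ f g []       = ↭-refl
concat-map-++ f g (x ∷ xs) = begin
  (f x ++ g x) ++ concat (map (λ x → f x ++ g x) xs)     ↭⟨ ↭.++⁺ˡ _ (concat-map-++ f g xs) ⟩
  (f x ++ g x) ++ (concat (map f xs) ++ concat (map g xs))  ↭⟨ interchange (f x) (g x) _ _ ⟩
  (f x ++ concat (map f xs)) ++ (g x ++ concat (map g xs))  ∎
  where
  open PermutationReasoning
  interchange : ∀ {B : Set} (a b c d : List B) → (a ++ b) ++ (c ++ d) ↭ (a ++ c) ++ (b ++ d)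
  interchange a b c d = begin
    (a ++ b) ++ (c ++ d)  ≡⟨ ++-assoc a b (c ++ d) ⟩
    a ++ (b ++ (c ++ d))  ≡⟨ cong (a ++_) (++-assoc b c d) ⟨
    a ++ ((b ++ c) ++ d)  ↭⟨ ↭.++⁺ˡ a (↭.++⁺ʳ d (↭.++-comm b c)) ⟩
    a ++ ((c ++ b) ++ d)  ≡⟨ cong (a ++_) (++-assoc c b d) ⟩
    a ++ (c ++ (b ++ d))  ≡⟨ ++-assoc a c (b ++ d) ⟨
    (a ++ c) ++ (b ++ d)  ∎

-- Certificates: encodings modulo the axioms 1 - x - x̄

encoding : Formula n → Poly n
encoding F = ∑ (map e F)

combination : (Fin n → Poly n) → Poly n
combination {n} r = ∑ (map (axiomMultiple r) (allFin n))

combination-single : ∀ (x : Fin n) p → combination (single x p) ≡ p ⊗ axiomPoly x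
combination-single x p = trans
  (cong ∑ (map-tabulate (λ j → j) (axiomMultiple (single x p))))
  (concat-single (λ j q → q ⊗ axiomPoly j) (λ _ → refl) x p)

-- A permutation rather than an equality, since summing over j interleaves the two families. Both
-- `coeff` and `formalNorm` are invariant under it.
combination-++ : ∀ (r r′ : Fin n → Poly n) → combination (λ j → r j ++ r′ j) ↭ combination r ++ combination r′
combination-++ {n} r r′ = ↭-trans
  (↭-reflexive (cong ∑ (map-cong (λ j → cartesianProductWith-distribʳ-++ _ (r j) (r′ j) (axiomPoly j)) (allFin n))))
  (concat-map-++ (axiomMultiple r) (axiomMultiple r′) (allFin n))

encoding-↭ : F ↭ G → encoding F ↭ encoding {n} G
encoding-↭ ↭.refl = ↭-refl
encoding-↭ (↭.prep C p) = ↭.++⁺ˡ (e C) (encoding-↭ p)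
encoding-↭ (↭.swap {xs} {ys} C D p) = begin
  e C ++ (e D ++ encoding xs)  ≡⟨ ++-assoc (e C) (e D) _ ⟨
  (e C ++ e D) ++ encoding xs  ↭⟨ ↭.++⁺ (↭.++-comm (e C) (e D)) (encoding-↭ p) ⟩
  (e D ++ e C) ++ encoding ys  ≡⟨ ++-assoc (e D) (e C) _ ⟩
  e D ++ (e C ++ encoding ys)  ∎
  where open PermutationReasoning
encoding-↭ (↭.trans p q) = ↭-trans (encoding-↭ p) (encoding-↭ q)

-- The polynomial trace of a rewriting with budget `k`. The factor 3 counts the terms of a monomial
-- times 1 - x - x̄, each with coefficient ±1. The additive norm makes the sizes of consecutive
-- certificates add up.
record Certificate {n} (F G : Formula n) (k : ℕ) : Set where
  field
    r        : Fin n → Poly n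
    identity : encoding F ≈ encoding G ⊕ combination r
    size     : formalNorm (combination r) ≤ 3 * k

encoding-∷ : ∀ (C : Clause n) F m →
             coeff (encoding (C ∷ F)) m ≡ coeff [ 1ℤ , monomial (lits C) ] m +ℤ coeff (encoding F) m
encoding-∷ C F m = trans (coeff-++ (e C) (encoding F) m)
  (cong (λ p → coeff p m +ℤ coeff (encoding F) m) (e-monomial C))

coeff-₃ : ∀ t u v (m : Monomial n) → coeff (t ∷ u ∷ v ∷ []) m ≡ coeff [ t ] m +ℤ (coeff [ u ] m +ℤ coeff [ v ] m)
coeff-₃ t u v m = trans (coeff-∷ t (u ∷ v ∷ []) m) (cong (coeff [ t ] m +ℤ_) (coeff-∷ u [ v ] m))

-- This is e(C) = e(C⁺) + e(C⁻) + e(C)(1 - x - x̄), so the multiplier at x is e(C) and all others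
-- are zero.
split-certificate : ∀ {x} {C C⁺ C⁻ : Clause n} → Splits x C C⁺ C⁻ → ∀ R → Certificate (C ∷ R) (C⁺ ∷ C⁻ ∷ R) 1
split-certificate {x = x} {C} {C⁺} {C⁻} s R = record
  { r = single x p ; identity = identity ; size = ℕ.≤-reflexive (cong formalNorm combined) }
  where
  p = [ 1ℤ , monomial (lits C) ]
  combined = trans (combination-single x p) (axiom-splits s 1ℤ)
  identity : encoding (C ∷ R) ≈ encoding (C⁺ ∷ C⁻ ∷ R) ⊕ combination (single x p)
  identity m
    rewrite coeff-++ (encoding (C⁺ ∷ C⁻ ∷ R)) (combination (single x p)) m | combined
          | coeff-₃ (1ℤ , monomial (lits C)) (-1ℤ , monomial (lits C⁻)) (-1ℤ , monomial (lits C⁺)) m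
          | coeff-neg 1ℤ (monomial (lits C⁻)) m | coeff-neg 1ℤ (monomial (lits C⁺)) m
          | encoding-∷ C R m | encoding-∷ C⁺ (C⁻ ∷ R) m | encoding-∷ C⁻ R m
    = ring (coeff [ 1ℤ , monomial (lits C) ] m) (coeff [ 1ℤ , monomial (lits C⁺) ] m)
           (coeff [ 1ℤ , monomial (lits C⁻) ] m) (coeff (encoding R) m)
    where
    ring : ∀ c c⁺ c⁻ r → c +ℤ r ≡ c⁺ +ℤ (c⁻ +ℤ r) +ℤ (c +ℤ (-ℤ c⁻ +ℤ -ℤ c⁺))
    ring = solve-∀

-- The identity of a split solved for e(C⁺) + e(C⁻), which negates the multiplier.
merge-certificate : ∀ {x} {C C⁺ C⁻ : Clause n} → Splits x C C⁺ C⁻ → ∀ R → Certificate (C⁺ ∷ C⁻ ∷ R) (C ∷ R) 1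
merge-certificate {x = x} {C} {C⁺} {C⁻} s R = record
  { r = single x p ; identity = identity ; size = ℕ.≤-reflexive (cong formalNorm combined) }
  where
  p = [ -1ℤ , monomial (lits C) ]
  combined = trans (combination-single x p) (axiom-splits s -1ℤ)
  identity : encoding (C⁺ ∷ C⁻ ∷ R) ≈ encoding (C ∷ R) ⊕ combination (single x p)
  identity m
    rewrite coeff-++ (encoding (C ∷ R)) (combination (single x p)) m | combined
          | coeff-₃ (-1ℤ , monomial (lits C)) (1ℤ , monomial (lits C⁻)) (1ℤ , monomial (lits C⁺)) m
          | coeff-neg 1ℤ (monomial (lits C)) m
          | encoding-∷ C R m | encoding-∷ C⁺ (C⁻ ∷ R) m | encoding-∷ C⁻ R m
    = ring (coeff [ 1ℤ , monomial (lits C) ] m) (coeff [ 1ℤ , monomial (lits C⁺) ] m)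
           (coeff [ 1ℤ , monomial (lits C⁻) ] m) (coeff (encoding R) m)
    where
    ring : ∀ c c⁺ c⁻ r → c⁺ +ℤ (c⁻ +ℤ r) ≡ c +ℤ r +ℤ (-ℤ c +ℤ (c⁻ +ℤ c⁺))
    ring = solve-∀

certificate : ∀ {F G : Formula n} → Rewrites k F G → Certificate F G k
certificate {n} {F = F} {G} (permute p) = record
  { r        = λ _ → []
  ; identity = λ m → trans (coeff-↭ (encoding-↭ p) m)
      (trans (cong (λ q → coeff q m) (sym (++-identityʳ (encoding G))))
             (cong (λ q → coeff (encoding G ++ q) m) (sym trivial)))
  ; size     = ℕ.≤-trans (ℕ.≤-reflexive (cong formalNorm trivial)) z≤n
  }
  where
  empties : ∀ {k} (js : List (Fin k)) → ∑ {n} (map (λ _ → []) js) ≡ []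
  empties []       = refl
  empties (_ ∷ js) = empties js
  trivial : combination {n} (λ _ → []) ≡ []
  trivial = empties (allFin n)
certificate (split {R = R} s) = split-certificate s R
certificate (merge {R = R} s) = merge-certificate s R
certificate {F = F} {G} (_then_ {k = k} {G = G₀} {l = l} r₁ r₂) = record
  { r        = λ j → C₁.r j ++ C₂.r j
  ; identity = identity
  ; size     = begin
      formalNorm (combination (λ j → C₁.r j ++ C₂.r j))              ≡⟨ formalNorm-↭ (combination-++ C₁.r C₂.r) ⟩
      formalNorm (combination C₁.r ++ combination C₂.r)              ≡⟨ formalNorm-++ (combination C₁.r) _ ⟩
      formalNorm (combination C₁.r) + formalNorm (combination C₂.r)  ≤⟨ ℕ.+-mono-≤ C₁.size C₂.size ⟩
      3 * k + 3 * l                                                  ≡⟨ ℕ.*-distribˡ-+ 3 k l ⟨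
      3 * (k + l)                                                    ∎
  }
  where
  open ℕ.≤-Reasoning
  module C₁ = Certificate (certificate r₁)
  module C₂ = Certificate (certificate r₂)
  identity : encoding F ≈ encoding G ⊕ combination (λ j → C₁.r j ++ C₂.r j)
  identity m
    rewrite coeff-++ (encoding G) (combination (λ j → C₁.r j ++ C₂.r j)) m
          | coeff-↭ (combination-++ C₁.r C₂.r) m | coeff-++ (combination C₁.r) (combination C₂.r) m
          | C₁.identity m | coeff-++ (encoding G₀) (combination C₁.r) m
          | C₂.identity m | coeff-++ (encoding G) (combination C₂.r) m
    = ring (coeff (encoding G) m) (coeff (combination C₁.r) m) (coeff (combination C₂.r) m)
    where
    ring : ∀ g a b → g +ℤ b +ℤ a ≡ g +ℤ (a +ℤ b)
    ring = solve-∀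

-- The Turing machine

isEndClause isEndFormula : Symbol → Bool
isEndClause endClause = true
isEndClause _         = false
isEndFormula endFormula = true
isEndFormula _          = false

data State : Set where
  scan trim seek halt : State
  carry               : Symbol → State

-- Here `a` is the carried symbol and `b` its left neighbour. The first disjunct does not look at
-- `a`, so the shift never enters an earlier formula.
stopsAt : Symbol → Symbol → Bool
stopsAt a b = isEndFormula b ∨ isEndClause a ∧ isEndClause b

transition : State → Maybe Symbol → Maybe (State × Maybe Symbol × Move)
transition scan      (just a) = just (scan , just a , right)
transition scan      nothing  = just (trim , nothing , left)
transition trim      (just a) = just (carry a , nothing , left)
transition trim      nothing  = nothing
transition (carry a) (just b) =
  if stopsAt a b then just (seek , just b , stay) else just (carry b , just a , left)
transition (carry a) nothing  = just (seek , nothing , stay)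
transition seek      (just b) =
  if isEndFormula b then just (halt , just b , right) else just (seek , just b , left)
transition seek      nothing  = just (halt , nothing , right)
transition halt      _        = nothing

-- Four control states, and one carrying state for each of the six symbols.
stateIndex : State → Fin 10
stateIndex scan                   = # 0
stateIndex trim                   = # 1
stateIndex seek                   = # 2
stateIndex halt                   = # 3
stateIndex (carry plus)           = # 4
stateIndex (carry minus)          = # 5
stateIndex (carry (bit zero))     = # 6
stateIndex (carry (bit (suc _)))  = # 7
stateIndex (carry endClause)      = # 8
stateIndex (carry endFormula)     = # 9

indexedState : Fin 10 → State
indexedState zero                                                   = scan
indexedState (suc zero)                                             = trim
indexedState (suc (suc zero))                                       = seek
indexedState (suc (suc (suc zero)))                                 = halt
indexedState (suc (suc (suc (suc zero))))                           = carry plus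
indexedState (suc (suc (suc (suc (suc zero)))))                     = carry minus
indexedState (suc (suc (suc (suc (suc (suc zero))))))               = carry (bit zero)
indexedState (suc (suc (suc (suc (suc (suc (suc zero)))))))         = carry (bit (suc zero))
indexedState (suc (suc (suc (suc (suc (suc (suc (suc zero))))))))   = carry endClause
indexedState (suc (suc (suc (suc (suc (suc (suc (suc (suc _)))))))))  = carry endFormula

-- This lets `δ` recover the state from its number, so that runs can be described entirely in terms
-- of `State` and `transition`.
indexedState-stateIndex : ∀ q → indexedState (stateIndex q) ≡ q
indexedState-stateIndex scan                        = refl
indexedState-stateIndex trim                        = refl
indexedState-stateIndex seek                        = refl
indexedState-stateIndex halt                        = refl
indexedState-stateIndex (carry plus)                = refl
indexedState-stateIndex (carry minus)               = refl
indexedState-stateIndex (carry (bit zero))          = refl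
indexedState-stateIndex (carry (bit (suc zero)))    = refl
indexedState-stateIndex (carry endClause)           = refl
indexedState-stateIndex (carry endFormula)          = refl

extractor : TM Symbol
extractor = record
  { states = 10
  ; start  = stateIndex scan
  ; δ      = λ i a → Maybe.map (λ (q , b , d) → stateIndex q , b , d) (transition (indexedState i) a)
  }

infix 5 _▹_
_▹_ : State → Tape Symbol → Config extractor
q ▹ t = stateIndex q , t

-- In tapeAt ls rs and tapeFrom ls v, the word ls is read from right to left.
tapeAt : List Symbol → List (Maybe Symbol) → Tape Symbol
tapeAt []       rs = tape [] nothing rs
tapeAt (a ∷ ls) rs = tape (map just ls) (just a) rs

tapeFrom : List Symbol → List Symbol → Tape Symbol
tapeFrom ls []      = tape (map just ls) nothing []
tapeFrom ls (a ∷ v) = tape (map just ls) (just a) (map just v)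

move-left : ∀ ls b rs → move left (tape (map just ls) b rs) ≡ tapeAt ls (b ∷ rs)
move-left []       b rs = refl
move-left (l ∷ ls) b rs = refl

move-right : ∀ ls a v → move right (tape (map just ls) (just a) (map just v)) ≡ tapeFrom (a ∷ ls) v
move-right ls a []      = refl
move-right ls a (b ∷ v) = refl

initialTape-tapeFrom : ∀ w → initialTape w ≡ tapeFrom [] w
initialTape-tapeFrom []      = refl
initialTape-tapeFrom (a ∷ w) = refl

infix 4 _↦_ _↠_
_↦_ _↠_ : Config extractor → Config extractor → Set
c ↦ c′ = next extractor c ≡ just c′
_↠_ = Star _↦_

step-↦ : ∀ q t q′ {b d t′} → transition q (Tape.head t) ≡ just (q′ , b , d) →
         move d (write b t) ≡ t′ → q ▹ t ↦ q′ ▹ t′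
step-↦ q t q′ eq refl rewrite indexedState-stateIndex q | eq = refl

next-nothing : ∀ q t → transition q (Tape.head t) ≡ nothing → next extractor (q ▹ t) ≡ nothing
next-nothing q t eq rewrite indexedState-stateIndex q | eq = refl

scan-right : ∀ ls a v → scan ▹ tapeFrom ls (a ∷ v) ↦ scan ▹ tapeFrom (a ∷ ls) v
scan-right ls a v = step-↦ scan (tapeFrom ls (a ∷ v)) scan refl (move-right ls a v)

scan-end : ∀ ls → scan ▹ tapeFrom ls [] ↦ trim ▹ tapeAt ls [ nothing ]
scan-end ls = step-↦ scan (tapeFrom ls []) trim refl (move-left ls nothing [])

trim-last : ∀ a ls rs → trim ▹ tapeAt (a ∷ ls) rs ↦ carry a ▹ tapeAt ls (nothing ∷ rs)
trim-last a ls rs = step-↦ trim (tapeAt (a ∷ ls) rs) (carry a) refl (move-left ls nothing rs)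

carry-left : ∀ a b ls rs → stopsAt a b ≡ false →
             carry a ▹ tapeAt (b ∷ ls) rs ↦ carry b ▹ tapeAt ls (just a ∷ rs)
carry-left a b ls rs eq = step-↦ (carry a) (tapeAt (b ∷ ls) rs) (carry b)
  (cong (if_then just (seek , just b , stay) else just (carry b , just a , left)) eq)
  (move-left ls (just a) rs)

carry-stop : ∀ a b ls rs → stopsAt a b ≡ true →
             carry a ▹ tapeAt (b ∷ ls) rs ↦ seek ▹ tapeAt (b ∷ ls) rs
carry-stop a b ls rs eq = step-↦ (carry a) (tapeAt (b ∷ ls) rs) seek
  (cong (if_then just (seek , just b , stay) else just (carry b , just a , left)) eq) refl

carry-blank : ∀ a rs → carry a ▹ tapeAt [] rs ↦ seek ▹ tapeAt [] rs
carry-blank a rs = step-↦ (carry a) (tapeAt [] rs) seek refl refl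

seek-left : ∀ b ls rs → isEndFormula b ≡ false →
            seek ▹ tapeAt (b ∷ ls) rs ↦ seek ▹ tapeAt ls (just b ∷ rs)
seek-left b ls rs eq = step-↦ seek (tapeAt (b ∷ ls) rs) seek
  (cong (if_then just (halt , just b , right) else just (seek , just b , left)) eq)
  (move-left ls (just b) rs)

seek-stop : ∀ b ls rs → isEndFormula b ≡ true →
            seek ▹ tapeAt (b ∷ ls) rs ↦ halt ▹ move right (tapeAt (b ∷ ls) rs)
seek-stop b ls rs eq = step-↦ seek (tapeAt (b ∷ ls) rs) halt
  (cong (if_then just (halt , just b , right) else just (seek , just b , left)) eq) refl

seek-blank : ∀ rs → seek ▹ tapeAt [] rs ↦ halt ▹ move right (tapeAt [] rs)
seek-blank rs = step-↦ seek (tapeAt [] rs) halt refl refl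

-- Running time of the machine

HaltsWithin : ℕ → Config extractor → Set
HaltsWithin N c = ∃[ k ] ∃[ c′ ] Halts extractor c k c′ × k ≤ N

halted-within : ∀ {c N} → next extractor c ≡ nothing → HaltsWithin N c
halted-within eq = 0 , _ , stop eq , z≤n

step-within : ∀ {c c′ N} → c ↦ c′ → HaltsWithin N c′ → HaltsWithin (suc N) c
step-within eq (k , c″ , h , k≤N) = suc k , c″ , run eq h , s≤s k≤N

halt-within : ∀ {N} t → HaltsWithin N (halt ▹ t)
halt-within t = halted-within (next-nothing halt t refl)

seek-within : ∀ ls rs → HaltsWithin (1 + length ls) (seek ▹ tapeAt ls rs)
seek-within []       rs = step-within (seek-blank rs) (halt-within _)
seek-within (b ∷ ls) rs with isEndFormula b in eq
... | true  = step-within (seek-stop b ls rs eq) (halt-within _)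
... | false = step-within (seek-left b ls rs eq) (seek-within ls _)

-- Carrying and seeking together cross each remaining cell at most once. The 2 pays for the
-- stationary change from `carry` to `seek` and for the final step into `halt`.
carry-within : ∀ a ls rs → HaltsWithin (2 + length ls) (carry a ▹ tapeAt ls rs)
carry-within a []       rs = step-within (carry-blank a rs) (seek-within [] rs)
carry-within a (b ∷ ls) rs with stopsAt a b in eq
... | true  = step-within (carry-stop a b ls rs eq) (seek-within (b ∷ ls) rs)
... | false = step-within (carry-left a b ls rs eq) (carry-within b ls _)

trim-within : ∀ ls rs → HaltsWithin (2 + length ls) (trim ▹ tapeAt ls rs)
trim-within []       rs = halted-within (next-nothing trim (tapeAt [] rs) refl)
trim-within (a ∷ ls) rs = step-within (trim-last a ls rs) (carry-within a ls _)

scan-within : ∀ ls v → HaltsWithin (length v + (3 + length (v ʳ++ ls))) (scan ▹ tapeFrom ls v)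
scan-within ls []      = step-within (scan-end ls) (trim-within ls _)
scan-within ls (a ∷ v) = step-within (scan-right ls a v) (scan-within (a ∷ ls) v)

-- The same number serves as exponent and as summand in `PolynomialTime`. A word of length 1 has
-- time bound 5, while 1 ^ d + d is 1 + d, which asks for d = 4.
linear≤quartic : ∀ L → L + (3 + L) ≤ L ^ 4 + 4
linear≤quartic 0 = s≤s (s≤s (s≤s z≤n))
linear≤quartic 1 = ℕ.≤-refl
linear≤quartic L@(suc (suc _)) = begin
  L + (3 + L)  ≡⟨ regroup L ⟩
  2 * L + 3    ≤⟨ ℕ.+-mono-≤ (ℕ.*-monoˡ-≤ L {2} {L} (s≤s (s≤s z≤n))) (ℕ.n≤1+n 3) ⟩
  L * L + 4    ≡⟨ cong (λ k → L * k + 4) (ℕ.*-identityʳ L) ⟨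
  L ^ 2 + 4    ≤⟨ ℕ.+-monoˡ-≤ 4 (ℕ.^-monoʳ-≤ L {2} {4} (s≤s (s≤s z≤n))) ⟩
  L ^ 4 + 4    ∎
  where
  open ℕ.≤-Reasoning
  regroup : ∀ L → L + (3 + L) ≡ 2 * L + 3
  regroup = ℕ-Solver.solve-∀

extractor-polynomialTime : PolynomialTime extractor
extractor-polynomialTime = 4 , λ w →
  let k , c , h , k≤ = scan-within [] w in
  k , c , subst (λ t → Halts extractor (scan ▹ t) k c) (sym (initialTape-tapeFrom w)) h ,
  ℕ.≤-trans k≤ (ℕ.≤-trans
    (ℕ.≤-reflexive (cong (λ l → length w + (3 + l)) (trans (length-ʳ++ w) (ℕ.+-identityʳ _))))
    (linear≤quartic (length w)))

-- Output of the machine on an encoded refutation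

scan-all : ∀ ls v → scan ▹ tapeFrom ls v ↠ trim ▹ tapeAt (v ʳ++ ls) [ nothing ]
scan-all ls []      = scan-end ls ◅ ε
scan-all ls (a ∷ v) = scan-right ls a v ◅ scan-all (a ∷ ls) v

-- The arguments follow the tape from left to right, so that `Linked CarriedOver w` says that a
-- shift coming from the right passes through `w` without stopping.
CarriedOver : Symbol → Symbol → Set
CarriedOver b a = stopsAt a b ≡ false

-- The head meets the right end of the word first, so the recursive call precedes the step over the
-- leftmost pair. In the end `p` is held by the state alone, its successors having moved up by one
-- cell.
carry-word : ∀ {p} v {a} ls rs → Linked CarriedOver (p ∷ v ++ [ a ]) →
             carry a ▹ tapeAt ((p ∷ v) ʳ++ ls) rs ↠ carry p ▹ tapeAt ls (map just (v ++ [ a ]) ++ rs)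
carry-word {p} []      {a} ls rs (pa ∷ _)      = carry-left a p ls rs pa ◅ ε
carry-word {p} (q ∷ v) ls rs (pq ∷ linked) =
  carry-word v (p ∷ ls) rs linked ◅◅ carry-left q p ls _ pq ◅ ε

seek-word : ∀ v ls rs → All (λ a → isEndFormula a ≡ false) v →
            seek ▹ tapeAt (v ʳ++ ls) rs ↠ seek ▹ tapeAt ls (map just v ++ rs)
seek-word []      ls rs []       = ε
seek-word (a ∷ v) ls rs (pa ∷ p) = seek-word v (a ∷ ls) rs p ◅◅ seek-left a ls _ pa ◅ ε

-- Describes what the head sees to the left of a sequence of blocks that all end in `t`: the marker
-- `t` of the last block or, if there is no block, whatever precedes the sequence. It serves for
-- clauses within a formula and for formulas within the input.
concatMap-ʳ++ : ∀ {A : Set} {t} (f g : A → List Symbol) → (∀ x → f x ≡ g x ++ [ t ]) →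
                ∀ xs ls → concatMap f xs ʳ++ ls ≡ ls ⊎ (∃[ ls′ ] concatMap f xs ʳ++ ls ≡ t ∷ ls′)
concatMap-ʳ++ f g f≡g []       ls = inj₁ refl
concatMap-ʳ++ f g f≡g (x ∷ xs) ls with concatMap-ʳ++ f g f≡g xs (f x ʳ++ ls)
... | inj₂ (ls′ , eq) = inj₂ (ls′ , trans (++-ʳ++ (f x)) eq)
... | inj₁ eq         = inj₂ (g x ʳ++ ls ,
  trans (++-ʳ++ (f x)) (trans eq (trans (cong (_ʳ++ ls) (f≡g x)) (++-ʳ++ (g x)))))

untilBlank-word : ∀ (w : List Symbol) rs → untilBlank (map just w ++ nothing ∷ rs) ≡ w
untilBlank-word []      rs = refl
untilBlank-word (a ∷ w) rs = cong (a ∷_) (untilBlank-word w rs)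

output-move-right : ∀ (t : Tape Symbol) → output (move right t) ≡ untilBlank (Tape.after t)
output-move-right (tape ls a [])       = refl
output-move-right (tape ls a (r ∷ rs)) = refl

after-tapeAt : ∀ ls rs → Tape.after (tapeAt ls rs) ≡ rs
after-tapeAt []       rs = refl
after-tapeAt (a ∷ ls) rs = refl

↠-halts : ∀ {c t} → c ↠ halt ▹ t → ∃[ k ] Halts extractor c k (halt ▹ t)
↠-halts {t = t} ε = 0 , stop (next-nothing halt t refl)
↠-halts (s ◅ ss) = let k , h = ↠-halts ss in suc k , run s h

record Plain (a : Symbol) : Set where
  constructor plain
  field
    ¬endClause  : isEndClause a ≡ false
    ¬endFormula : isEndFormula a ≡ false

open Plain

wordLit-plain : ∀ (l : Literal n) → All Plain (wordLit l)
wordLit-plain (pos x) = plain refl refl ∷ All.map⁺ (All.universal (λ _ → plain refl refl) _)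
wordLit-plain (neg x) = plain refl refl ∷ All.map⁺ (All.universal (λ _ → plain refl refl) _)

wordLits-plain : ∀ (ls : List (Literal n)) → All Plain (concatMap wordLit ls)
wordLits-plain ls = All.concat⁺ (All.map⁺ (All.universal wordLit-plain ls))

wordClauses-¬endFormula : ∀ (F : Formula n) → All (λ a → isEndFormula a ≡ false) (concatMap wordClause F)
wordClauses-¬endFormula F = All.concat⁺ (All.map⁺ (All.universal
  (λ C → All.++⁺ (All.map ¬endFormula (wordLits-plain (literals (lits C)))) (refl ∷ [])) F))

linked-plain : ∀ {p w v} → Plain p → All Plain w →
               Linked CarriedOver (endClause ∷ v) → Linked CarriedOver (p ∷ w ++ endClause ∷ v)
linked-plain p []       linked = cong₂ _∨_ (¬endFormula p) (¬endClause p) ∷ linked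
linked-plain p (_∷_ {x = q} pq w) linked =
  cong₂ _∨_ (¬endFormula p) (trans (cong (isEndClause q ∧_) (¬endClause p)) (∧-zeroʳ _)) ∷ linked-plain pq w linked

-- A nonempty clause keeps its end marker apart from the preceding one, so no adjacent pair meets
-- the stopping condition.
linked-clause : ∀ {w v} → All Plain w → ¬ w ≡ [] →
                Linked CarriedOver (endClause ∷ v) → Linked CarriedOver (endClause ∷ w ++ endClause ∷ v)
linked-clause []       w≢[] _      = contradiction refl w≢[]
linked-clause (p ∷ ps) _    linked = cong (_∧ true) (¬endClause p) ∷ linked-plain p ps linked

wordLits≢[] : ∀ (ls : List (Literal n)) → ¬ ls ≡ [] → ¬ concatMap wordLit ls ≡ []
wordLits≢[] []           ls≢[] = contradiction refl ls≢[]
wordLits≢[] (pos x ∷ ls) _     = λ ()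
wordLits≢[] (neg x ∷ ls) _     = λ ()

Nonempty : Clause n → Set
Nonempty C = ¬ literals (lits C) ≡ []

-- The leading `endClause` is the marker of the empty clause to be deleted: the shift passes over
-- all nonempty clauses behind it and picks it up.
linked-clauses : ∀ (F : Formula n) → All Nonempty F →
                 Linked CarriedOver (endClause ∷ concatMap wordClause F ++ [ endFormula ])
linked-clauses []      []                = refl ∷ [-]
linked-clauses (C ∷ F) (nonempty ∷ rest) =
  subst (λ v → Linked CarriedOver (endClause ∷ v))
        (sym (trans (++-assoc (wordClause C) _ _) (++-assoc (concatMap wordLit (literals (lits C))) _ _)))
        (linked-clause (wordLits-plain (literals (lits C))) (wordLits≢[] _ nonempty) (linked-clauses F rest))

carry-seek : ∀ a ls rs → ls ≡ [] ⊎ (∃[ ls′ ] ls ≡ endFormula ∷ ls′) →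
             carry a ▹ tapeAt ls rs ↠ seek ▹ tapeAt ls rs
carry-seek a _ rs (inj₁ refl)         = carry-blank a rs ◅ ε
carry-seek a _ rs (inj₂ (ls′ , refl)) = carry-stop a endFormula ls′ rs refl ◅ ε

seek-boundary : ∀ ls rs → ls ≡ [] ⊎ (∃[ ls′ ] ls ≡ endFormula ∷ ls′) →
                seek ▹ tapeAt ls rs ↠ halt ▹ move right (tapeAt ls rs)
seek-boundary _ rs (inj₁ refl)         = seek-blank rs ◅ ε
seek-boundary _ rs (inj₂ (ls′ , refl)) = seek-stop endFormula ls′ rs refl ◅ ε

-- Nonemptiness of the clauses in `G` makes `C` the last empty clause, which is the first one that
-- the shift, coming from the right, can detect.
extractor-deletes : ∀ (Φ : List (Formula n)) F C G → literals (lits C) ≡ [] → All Nonempty G →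
                    Computes extractor (concatMap wordFormula (Φ ++ [ F ++ C ∷ G ])) (wordFormula (F ++ G))
extractor-deletes Φ F C G empty nonempty =
  let k , h = ↠-halts path in
  k , _ , subst (λ t → Halts extractor (scan ▹ t) k (halt ▹ move right (tapeAt u rs)))
                (sym (initialTape-tapeFrom input)) h ,
  (begin
    output (move right (tapeAt u rs))                               ≡⟨ output-move-right (tapeAt u rs) ⟩
    untilBlank (Tape.after (tapeAt u rs))                           ≡⟨ cong untilBlank (after-tapeAt u rs) ⟩
    untilBlank (map just f ++ map just (g ++ [ endFormula ]) ++ blanks)
      ≡⟨ cong untilBlank (++-assoc (map just f) _ _) ⟨
    untilBlank ((map just f ++ map just (g ++ [ endFormula ])) ++ blanks)
      ≡⟨ cong (λ w → untilBlank (w ++ blanks)) (map-++ just f _) ⟨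
    untilBlank (map just (f ++ g ++ [ endFormula ]) ++ blanks)      ≡⟨ untilBlank-word (f ++ g ++ [ endFormula ]) _ ⟩
    f ++ g ++ [ endFormula ]                                        ≡⟨ ++-assoc f g _ ⟨
    (f ++ g) ++ [ endFormula ]                                      ≡⟨ cong (_++ [ endFormula ]) (concatMap-++ wordClause F G) ⟨
    wordFormula (F ++ G)                                            ∎)
  where
  open ≡-Reasoning
  f g input u : List Symbol
  f = concatMap wordClause F
  g = concatMap wordClause G
  input = concatMap wordFormula (Φ ++ [ F ++ C ∷ G ])
  -- The earlier formulas, which stay on the tape to the left of the output.
  u = concatMap wordFormula Φ ʳ++ []
  blanks rs : List (Maybe Symbol)
  -- The cell vacated by the shift, followed by the blank at which the scan turned around; the
  -- former ends the output.
  blanks = nothing ∷ nothing ∷ []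
  rs = map just f ++ map just (g ++ [ endFormula ]) ++ blanks

  wordC : wordClause C ≡ [ endClause ]
  wordC = cong (λ ls → concatMap wordLit ls ++ [ endClause ]) empty

  last-formula : concatMap wordFormula [ F ++ C ∷ G ] ≡ f ++ endClause ∷ g ++ [ endFormula ]
  last-formula = begin
    wordFormula (F ++ C ∷ G) ++ []                   ≡⟨ ++-identityʳ _ ⟩
    concatMap wordClause (F ++ C ∷ G) ++ [ endFormula ]
      ≡⟨ cong (_++ [ endFormula ]) (concatMap-++ wordClause F (C ∷ G)) ⟩
    (f ++ wordClause C ++ g) ++ [ endFormula ]       ≡⟨ cong (λ w → (f ++ w ++ g) ++ [ endFormula ]) wordC ⟩
    (f ++ endClause ∷ g) ++ [ endFormula ]           ≡⟨ ++-assoc f _ _ ⟩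
    f ++ endClause ∷ g ++ [ endFormula ]             ∎

  reversed : input ʳ++ [] ≡ endFormula ∷ (endClause ∷ g) ʳ++ (f ʳ++ u)
  reversed = begin
    input ʳ++ []
      ≡⟨ cong (_ʳ++ []) (concatMap-++ wordFormula Φ _) ⟩
    (concatMap wordFormula Φ ++ concatMap wordFormula [ F ++ C ∷ G ]) ʳ++ []
      ≡⟨ ++-ʳ++ (concatMap wordFormula Φ) ⟩
    concatMap wordFormula [ F ++ C ∷ G ] ʳ++ u
      ≡⟨ cong (_ʳ++ u) last-formula ⟩
    (f ++ endClause ∷ g ++ [ endFormula ]) ʳ++ u
      ≡⟨ ++-ʳ++ f ⟩
    (g ++ [ endFormula ]) ʳ++ (endClause ∷ f ʳ++ u)
      ≡⟨ ++-ʳ++ g ⟩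
    endFormula ∷ (endClause ∷ g) ʳ++ (f ʳ++ u)
      ∎

  boundary : u ≡ [] ⊎ (∃[ ls ] u ≡ endFormula ∷ ls)
  boundary = concatMap-ʳ++ wordFormula (concatMap wordClause) (λ _ → refl) Φ []

  -- To the left of the carried marker there is the end marker of the last clause of `F`, or, if `F`
  -- has none, the end marker of the preceding formula or the start of the tape. In each case the
  -- carried symbol is dropped, and this is the deletion.
  found : carry endClause ▹ tapeAt (f ʳ++ u) (map just (g ++ [ endFormula ]) ++ blanks) ↠
          seek ▹ tapeAt (f ʳ++ u) (map just (g ++ [ endFormula ]) ++ blanks)
  found with concatMap-ʳ++ wordClause (λ D → concatMap wordLit (literals (lits D))) (λ _ → refl) F u
  ... | inj₁ eq         = carry-seek endClause _ _
    (Sum.map (trans eq) (λ (ls , eq′) → ls , trans eq eq′) boundary)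
  ... | inj₂ (ls , eq) rewrite eq = carry-stop endClause endClause ls _ refl ◅ ε

  path : scan ▹ tapeFrom [] input ↠ halt ▹ move right (tapeAt u rs)
  path =
    subst (λ ls → scan ▹ tapeFrom [] input ↠ trim ▹ tapeAt ls [ nothing ]) reversed (scan-all [] input) ◅◅
    trim-last endFormula _ _ ◅
    carry-word g (f ʳ++ u) blanks (linked-clauses G nonempty) ◅◅
    found ◅◅
    seek-word f u _ (wordClauses-¬endFormula F) ◅◅
    seek-boundary u _ boundary

-- Removal of an empty clause and the final bounds

record LastEmpty (F : Formula n) : Set where
  constructor lastEmpty
  field
    {before}  : Formula n
    {⊥-clause}  : Clause n
    {after}   : Formula n
    splitting : F ≡ before ++ ⊥-clause ∷ after
    empty     : literals (lits ⊥-clause) ≡ []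
    nonempty  : All Nonempty after

-- The tail is searched before the head is inspected, so the empty clause found is the last one, as
-- the machine requires.
nonempty⊎lastEmpty : ∀ (F : Formula n) → All Nonempty F ⊎ LastEmpty F
nonempty⊎lastEmpty [] = inj₁ []
nonempty⊎lastEmpty (C ∷ F) with nonempty⊎lastEmpty F
... | inj₂ (lastEmpty {before} eq empty rest) = inj₂ (lastEmpty {before = C ∷ before} (cong (C ∷_) eq) empty rest)
... | inj₁ rest with literals (lits C) in eq
... | []    = inj₂ (lastEmpty {before = []} refl eq rest)
... | _ ∷ _ = inj₁ ((λ eq′ → contradiction (trans (sym eq) eq′) λ ()) ∷ rest)

find-empty : ∀ (F : Formula n) → ContainsEmptyClause F → LastEmpty F
find-empty F contains with nonempty⊎lastEmpty F
... | inj₂ found    = found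
... | inj₁ nonempty = contradiction contains (none nonempty)
  where
  none : ∀ {F} → All Nonempty F → ¬ ContainsEmptyClause F
  none (¬[] ∷ _)    (here eq)        = ¬[] (literals-empty eq)
  none (_ ∷ rest)   (there contains) = none rest contains

-- The encoding of the empty clause `C` is the empty product, which is the constant 1 of the
-- representation; the rest is the identity of the certificate brought to one side.
sa-representation : ∀ {F G : Formula n} {C} → literals (lits C) ≡ [] → (c : Certificate F (C ∷ G) k) →
                    SARepresentation F G (Certificate.r c)
sa-representation {n} {F = F} {G} {C} empty c = vanishes
  where
  f g a : Poly n
  f = encoding F
  g = encoding G
  a = combination (Certificate.r c)
  ring : ∀ o g a → -ℤ (o +ℤ g +ℤ a) +ℤ a +ℤ g +ℤ o ≡ 0ℤ
  ring = solve-∀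
  vanishes : (⊖ f) ⊕ a ⊕ g ⊕ 𝟙 ≈ 𝟘
  vanishes m
    rewrite coeff-++ ((⊖ f) ⊕ a ⊕ g) 𝟙 m | coeff-++ ((⊖ f) ⊕ a) g m | coeff-++ (⊖ f) a m | coeff-⊖ f m
          | Certificate.identity c m | coeff-++ (encoding (C ∷ G)) a m | coeff-++ (e C) g m
          | cong (λ ls → coeff (∏ (map encodeLit ls)) m) empty
    = ring (coeff 𝟙 m) (coeff g m) (coeff a m)

proposition2p1 : Σ[ M ∈ TM Symbol ] Σ[ K ∈ ℕ ]
    PolynomialTime M ×
    (∀ (n m s : ℕ) (F : Formula n) → length F ≡ m → Unsatisfiable F →
    (π : MaxResW F s) →
    Σ[ G ∈ Formula n ]
    Computes M (wordRefutation π) (wordFormula G) ×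
    SubCubeSums F G ×
    combinatorialSize G ≤ K * (m + n * s) ×
    AlgebraicSizeAtMost F G (K * (m + n * s)))
proposition2p1 = extractor , 16 , extractor-polynomialTime , λ n m s F ∣F∣≡m _ π →
  let
    Φ , multisets≡ = multisets-final π
    k , k≤ , rewrites = refutation-rewrites π
    lastEmpty {F₁} {C} {F₂} final≡ empty nonempty = find-empty (final π) (final-contains-empty π)
    G = F₁ ++ F₂
    final↭ : final π ↭ C ∷ G
    final↭ = ↭-trans (↭-reflexive final≡) (↭.shift C F₁ F₂)
    rewrites′ = permuteʳ rewrites final↭
    c = certificate rewrites′
    ∣G∣≤ : length G ≤ m + k
    ∣G∣≤ = ℕ.≤-trans (ℕ.n≤1+n _) (subst (λ m → suc (length G) ≤ m + k) ∣F∣≡m (length-Rewrites rewrites′))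
    k≤′ : k ≤ 4 * (n * s)
    k≤′ = ℕ.≤-trans k≤ (ℕ.≤-reflexive (s[4n]≡4[ns] s n))
    -- The summands bound the number of clauses of F, that of G, and the norms of the axiom
    -- multiples. They add up to 2m + 4k, and k ≤ 4ns turns 4k into at most 16ns, which fixes the
    -- constant 16.
    total : m + (m + k) + 3 * k ≤ 16 * (m + n * s)
    total = size-bound m k (n * s) k≤′
  in
  G ,
  subst (λ w → Computes extractor w (wordFormula G))
    (cong (concatMap wordFormula) (sym (trans multisets≡ (cong (λ F → Φ ++ [ F ]) final≡))))
    (extractor-deletes Φ F₁ C F₂ empty nonempty) ,
  (λ α → trans (viol-Rewrites rewrites′ α)
    (trans (viol-∷ C G α) (cong (λ b → bit⟨ b ⟩ + viol G α) (falsified-empty {C = C} empty α)))) ,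
  ℕ.≤-trans ∣G∣≤ (ℕ.≤-trans (ℕ.≤-trans (ℕ.m≤n+m (m + k) m) (ℕ.m≤m+n _ (3 * k))) total) ,
  (Certificate.r c , sa-representation empty c ,
    ℕ.≤-trans
      (ℕ.+-mono-≤ (ℕ.+-mono-≤ (ℕ.≤-reflexive ∣F∣≡m) ∣G∣≤)
        (ℕ.≤-trans (norms≤formalNorm (axiomMultiple (Certificate.r c)) (allFin n)) (Certificate.size c)))
      total)
  where
  s[4n]≡4[ns] : ∀ s n → s * (4 * n) ≡ 4 * (n * s)
  s[4n]≡4[ns] = ℕ-Solver.solve-∀
  regroup : ∀ m k → m + (m + k) + 3 * k ≡ 2 * m + 4 * k
  regroup = ℕ-Solver.solve-∀
  collect : ∀ m t → 16 * m + 4 * (4 * t) ≡ 16 * (m + t)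
  collect = ℕ-Solver.solve-∀
  size-bound : ∀ m k t → k ≤ 4 * t → m + (m + k) + 3 * k ≤ 16 * (m + t)
  size-bound m k t k≤ = begin
    m + (m + k) + 3 * k   ≡⟨ regroup m k ⟩
    2 * m + 4 * k         ≤⟨ ℕ.+-mono-≤ (ℕ.*-monoˡ-≤ m {2} {16} (s≤s (s≤s z≤n))) (ℕ.*-monoʳ-≤ 4 k≤) ⟩
    16 * m + 4 * (4 * t)  ≡⟨ collect m t ⟩
    16 * (m + t)          ∎
    where open ℕ.≤-Reasoning
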